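{- Let $\Gamma$ be a finite simple $k$-regular graph. Then for all sufficiently large $n$, the generalised CAP bound for $\Gamma\,\square\,C_n$ is strictly smaller than the Hoffman bound for $\Gamma\,\square\,C_n$.
   Context: $\Gamma\,\square\,C_n$ is the Cartesian product of $\Gamma$ with the cycle $C_n$ on $n$ vertices. For a finite simple graph $G$ on $v$ vertices, and a positive integer $s$, let $$\mathrm{CA}_G(x,s,\kappa,\lambda):=x(x+1)(v-s)-2xs(\kappa-s+1)+s(s-1)(\lambda-s+2).$$ The edge-degree of an edge is the number of common neighbours of its two endpoints. Let $G$ have at least one edge, let $\delta,\Delta$ be its minimum and maximum vertex degrees, and $\lambda_{\min},\lambda_{\max}$ the minimum and maximum edge-degrees of its edges. For every clique of $G$ with at least two vertices, the average vertex degree in $G$ over the clique lies in $[\delta,\Delta]$ and the average edge-degree in $G$ over pairs of vertices in the clique lies in $[\lambda_{\min},\lambda_{\max}]$. If for every real pair $(\kappa,\lambda)\in[\delta,\Delta]\times[\lambda_{\min},\lambda_{\max}]$ there is an integer $x$ with $\mathrm{CA}_G(x,s,\kappa,\lambda)<0$, then $G$ has no $s$-clique. The generalised CAP bound for $G$ is the least value of $s-1$ over all positive integers $s$ with this property. The Hoffman bound for a $d$-regular graph $G$ on $v$ vertices is the real number $\dfrac{v(1+\gamma_2)}{v-d+\gamma_2}$, where $\gamma_2$ is the second-largest eigenvalue (counted with multiplicity) of the adjacency matrix of $G$. -}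

module Defs where

open import Algebra.Bundles.Raw using (RawRing)
open import Data.Fin.Base using (Fin; zero; suc; toℕ; punchIn; remQuot)
import Data.Fin.Base as Fin
import Data.Fin.Properties as Fin
open import Data.Integer.Base as ℤ using (ℤ; +_)
open import Data.List.Base using (List; length; filter; map; allFin; cartesianProduct)
open import Data.List.Extrema.Nat using (min; max)
open import Data.Nat.Base as ℕ using (ℕ; zero; suc)
import Data.Nat.Properties as ℕ
open import Data.Product.Base using (∃-syntax; ∃₂; _×_; _,_; proj₁; proj₂)
open import Data.Rational.Base as ℚ using (ℚ; 0ℚ; 1ℚ; ½)
import Data.Rational.Properties as ℚ
open import Data.Rational.Solver using (module +-*-Solver)
open import Data.Sum.Base using (_⊎_; inj₁; inj₂; [_,_]; swap)
open import Function.Base using (_∘_)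
open import Level using (0ℓ)
open import Relation.Binary.Core using (Rel)
open import Relation.Binary.Definitions using (Decidable; Symmetric)
open import Relation.Binary.PropositionalEquality
  using (_≡_; _≢_; refl; sym; trans; cong; cong₂; subst)
open import Relation.Nullary.Decidable using (yes; no; _×-dec_; _⊎-dec_; ¬?)
open import Relation.Nullary.Negation using (¬_; contradiction)

-- Real numbers are Cauchy sequences of rationals, identified by _≈_.

IsCauchy : (ℕ → ℚ) → Set
IsCauchy f = ∀ ε → 0ℚ ℚ.< ε →
  ∃[ N ] ∀ m n → N ℕ.≤ m → N ℕ.≤ n → ℚ.∣ f m ℚ.- f n ∣ ℚ.< ε

record ℝ : Set where
  constructor mkℝ
  field
    seq    : ℕ → ℚ
    cauchy : IsCauchy seq

open ℝ public

infix 4 _≈_ _<_ _≤_ _#_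

record _≈_ (x y : ℝ) : Set where
  constructor mk≈
  field
    close : ∀ ε → 0ℚ ℚ.< ε →
      ∃[ N ] ∀ n → N ℕ.≤ n → ℚ.∣ seq x n ℚ.- seq y n ∣ ℚ.< ε

record _<_ (x y : ℝ) : Set where
  constructor mk<
  field
    gap       : ℚ
    0<gap     : 0ℚ ℚ.< gap
    separated : ∃[ N ] ∀ n → N ℕ.≤ n → seq x n ℚ.+ gap ℚ.≤ seq y n

_≤_ : Rel ℝ 0ℓ
x ≤ y = ¬ (y < x)

_#_ : Rel ℝ 0ℓ
x # y = x < y ⊎ y < x

private
  module Ring = +-*-Solver

  0<½ε : ∀ {ε} → 0ℚ ℚ.< ε → 0ℚ ℚ.< ½ ℚ.* ε
  0<½ε {ε} 0<ε = subst (ℚ._< ½ ℚ.* ε) (ℚ.*-zeroʳ ½) (ℚ.*-monoʳ-<-pos ½ 0<ε)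

  ½ε+½ε : ∀ ε → ½ ℚ.* ε ℚ.+ ½ ℚ.* ε ≡ ε
  ½ε+½ε ε = trans (sym (ℚ.*-distribʳ-+ ε ½ ½)) (ℚ.*-identityˡ ε)

  shrink : ∀ {A ε} → 0ℚ ℚ.< A → 0ℚ ℚ.< ε → ∃[ η ] 0ℚ ℚ.< η × A ℚ.* η ≡ ε
  shrink {A} {ε} 0<A 0<ε = 1/A ℚ.* ε , 0<η , A*η≡ε
    where
    instance
      A-pos : ℚ.Positive A
      A-pos = ℚ.positive 0<A
      A-nonZero : ℚ.NonZero A
      A-nonZero = ℚ.pos⇒nonZero A
    1/A = ℚ.1/ A
    instance
      1/A-pos : ℚ.Positive 1/A
      1/A-pos = ℚ.1/pos⇒pos A
    0<η : 0ℚ ℚ.< 1/A ℚ.* ε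
    0<η = subst (ℚ._< 1/A ℚ.* ε) (ℚ.*-zeroʳ 1/A) (ℚ.*-monoʳ-<-pos 1/A 0<ε)
    A*η≡ε : A ℚ.* (1/A ℚ.* ε) ≡ ε
    A*η≡ε = trans (sym (ℚ.*-assoc A 1/A ε))
      (trans (cong (ℚ._* ε) (ℚ.*-inverseʳ A)) (ℚ.*-identityˡ ε))

  *-mono-≤-< : ∀ {a A b η} → 0ℚ ℚ.≤ b → 0ℚ ℚ.< A → a ℚ.≤ A → b ℚ.< η →
               a ℚ.* b ℚ.< A ℚ.* η
  *-mono-≤-< {a} {A} {b} {η} 0≤b 0<A a≤A b<η = ℚ.≤-<-trans
    (ℚ.*-monoʳ-≤-nonNeg b {{ℚ.nonNegative 0≤b}} a≤A)
    (ℚ.*-monoʳ-<-pos A {{ℚ.positive 0<A}} b<η)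

  *-mono-≤ : ∀ {a A b B} → 0ℚ ℚ.≤ b → 0ℚ ℚ.≤ A → a ℚ.≤ A → b ℚ.≤ B →
             a ℚ.* b ℚ.≤ A ℚ.* B
  *-mono-≤ {a} {A} {b} {B} 0≤b 0≤A a≤A b≤B = ℚ.≤-trans
    (ℚ.*-monoʳ-≤-nonNeg b {{ℚ.nonNegative 0≤b}} a≤A)
    (ℚ.*-monoˡ-≤-nonNeg A {{ℚ.nonNegative 0≤A}} b≤B)

  ∣-∣-comm : ∀ p q → ℚ.∣ p ℚ.- q ∣ ≡ ℚ.∣ q ℚ.- p ∣
  ∣-∣-comm p q = trans (sym (ℚ.∣-p∣≡∣p∣ (p ℚ.- q)))
    (cong ℚ.∣_∣ (Ring.solve 2 (λ p q → Ring.:- (p Ring.:- q) Ring.:= q Ring.:- p) refl p q))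

  bounded : ∀ x → ∃[ B ] 0ℚ ℚ.< B × ∃[ N ] ∀ n → N ℕ.≤ n → ℚ.∣ seq x n ∣ ℚ.≤ B
  bounded x with cauchy x 1ℚ (ℚ.positive⁻¹ 1ℚ)
  ... | N , close = B , 0<B , N , bound
    where
    B = 1ℚ ℚ.+ ℚ.∣ seq x N ∣
    0<B : 0ℚ ℚ.< B
    0<B = ℚ.<-≤-trans (ℚ.positive⁻¹ 1ℚ)
      (subst (ℚ._≤ B) (ℚ.+-identityʳ 1ℚ) (ℚ.+-monoʳ-≤ 1ℚ (ℚ.0≤∣p∣ (seq x N))))
    split : ∀ p q → (p ℚ.- q) ℚ.+ q ≡ p
    split = Ring.solve 2 (λ p q → (p Ring.:- q) Ring.:+ q Ring.:= p) refl
    bound : ∀ n → N ℕ.≤ n → ℚ.∣ seq x n ∣ ℚ.≤ B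
    bound n N≤n = ℚ.≤-trans
      (subst (λ t → ℚ.∣ t ∣ ℚ.≤ ℚ.∣ seq x n ℚ.- seq x N ∣ ℚ.+ ℚ.∣ seq x N ∣)
        (split (seq x n) (seq x N)) (ℚ.∣p+q∣≤∣p∣+∣q∣ (seq x n ℚ.- seq x N) (seq x N)))
      (ℚ.+-monoˡ-≤ ℚ.∣ seq x N ∣ (ℚ.<⇒≤ (close n N N≤n ℕ.≤-refl)))

-- The proofs of IsCauchy are abstract because real numbers are compared
-- through seq only, and unfolding them makes normal forms very large.
abstract
  const-cauchy : ∀ q → IsCauchy (λ _ → q)
  const-cauchy q ε 0<ε = 0 , λ _ _ _ _ →
    subst (ℚ._< ε) (sym (cong ℚ.∣_∣ (ℚ.+-inverseʳ q))) 0<ε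

fromℚ : ℚ → ℝ
fromℚ q = mkℝ (λ _ → q) (const-cauchy q)

fromℤ : ℤ → ℝ
fromℤ z = fromℚ (z ℚ./ 1)

fromℕ : ℕ → ℝ
fromℕ n = fromℤ (+ n)

0ℝ 1ℝ : ℝ
0ℝ = fromℕ 0
1ℝ = fromℕ 1

infixl 6 _+_ _-_
infixl 7 _*_
infix  8 -_

abstract
  +-cauchy : ∀ x y → IsCauchy (λ n → seq x n ℚ.+ seq y n)
  +-cauchy x y ε 0<ε with cauchy x (½ ℚ.* ε) (0<½ε 0<ε) | cauchy y (½ ℚ.* ε) (0<½ε 0<ε)
  ... | M , closeˣ | N , closeʸ = M ℕ.⊔ N , λ m n ≤m ≤n → ℚ.≤-<-trans
    (subst (λ t → ℚ.∣ t ∣ ℚ.≤ ℚ.∣ seq x m ℚ.- seq x n ∣ ℚ.+ ℚ.∣ seq y m ℚ.- seq y n ∣)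
      (sym (regroup (seq x m) (seq y m) (seq x n) (seq y n)))
      (ℚ.∣p+q∣≤∣p∣+∣q∣ (seq x m ℚ.- seq x n) (seq y m ℚ.- seq y n)))
    (subst (ℚ.∣ seq x m ℚ.- seq x n ∣ ℚ.+ ℚ.∣ seq y m ℚ.- seq y n ∣ ℚ.<_) (½ε+½ε ε)
      (ℚ.+-mono-<
        (closeˣ m n (ℕ.m⊔n≤o⇒m≤o M N ≤m) (ℕ.m⊔n≤o⇒m≤o M N ≤n))
        (closeʸ m n (ℕ.m⊔n≤o⇒n≤o M N ≤m) (ℕ.m⊔n≤o⇒n≤o M N ≤n))))
    where
    regroup : ∀ a b c d → (a ℚ.+ b) ℚ.- (c ℚ.+ d) ≡ (a ℚ.- c) ℚ.+ (b ℚ.- d)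
    regroup = Ring.solve 4 (λ a b c d →
      (a Ring.:+ b) Ring.:- (c Ring.:+ d) Ring.:= (a Ring.:- c) Ring.:+ (b Ring.:- d)) refl

_+_ : ℝ → ℝ → ℝ
x + y = mkℝ (λ n → seq x n ℚ.+ seq y n) (+-cauchy x y)

abstract
  neg-cauchy : ∀ x → IsCauchy (λ n → ℚ.- seq x n)
  neg-cauchy x ε 0<ε = let N , close = cauchy x ε 0<ε in
    N , λ m n ≤m ≤n → subst (ℚ._< ε) (flip-sign (seq x m) (seq x n)) (close m n ≤m ≤n)
    where
    flip-sign : ∀ p q → ℚ.∣ p ℚ.- q ∣ ≡ ℚ.∣ (ℚ.- p) ℚ.- (ℚ.- q) ∣
    flip-sign p q = trans (sym (ℚ.∣-p∣≡∣p∣ (p ℚ.- q)))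
      (cong ℚ.∣_∣ (ℚ.neg-distrib-+ p (ℚ.- q)))

-_ : ℝ → ℝ
- x = mkℝ (λ n → ℚ.- seq x n) (neg-cauchy x)

_-_ : ℝ → ℝ → ℝ
x - y = x + (- y)

private
  product-close : ∀ {A B ε η θ a b c d} → 0ℚ ℚ.< A → 0ℚ ℚ.< B →
    A ℚ.* η ≡ ½ ℚ.* ε → B ℚ.* θ ≡ ½ ℚ.* ε →
    ℚ.∣ a ∣ ℚ.≤ A → ℚ.∣ d ∣ ℚ.≤ B → ℚ.∣ b ℚ.- d ∣ ℚ.< η → ℚ.∣ a ℚ.- c ∣ ℚ.< θ →
    ℚ.∣ a ℚ.* b ℚ.- c ℚ.* d ∣ ℚ.< ε
  product-close {A} {B} {ε} {η} {θ} {a} {b} {c} {d} 0<A 0<B Aη≡½ε Bθ≡½ε a≤A d≤B b-d<η a-c<θ =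
    subst (λ t → ℚ.∣ t ∣ ℚ.< ε) (sym (regroup a b c d))
      (ℚ.≤-<-trans (ℚ.∣p+q∣≤∣p∣+∣q∣ (a ℚ.* (b ℚ.- d)) (d ℚ.* (a ℚ.- c)))
        (subst (ℚ.∣ a ℚ.* (b ℚ.- d) ∣ ℚ.+ ℚ.∣ d ℚ.* (a ℚ.- c) ∣ ℚ.<_) (½ε+½ε ε)
          (ℚ.+-mono-<
            (half a (b ℚ.- d) 0<A Aη≡½ε a≤A b-d<η)
            (half d (a ℚ.- c) 0<B Bθ≡½ε d≤B a-c<θ))))
    where
    regroup : ∀ a b c d → a ℚ.* b ℚ.- c ℚ.* d ≡ a ℚ.* (b ℚ.- d) ℚ.+ d ℚ.* (a ℚ.- c)
    regroup = Ring.solve 4 (λ a b c d →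
      a Ring.:* b Ring.:- c Ring.:* d Ring.:=
      a Ring.:* (b Ring.:- d) Ring.:+ d Ring.:* (a Ring.:- c)) refl
    half : ∀ p q {P Q} → 0ℚ ℚ.< P → P ℚ.* Q ≡ ½ ℚ.* ε → ℚ.∣ p ∣ ℚ.≤ P → ℚ.∣ q ∣ ℚ.< Q →
           ℚ.∣ p ℚ.* q ∣ ℚ.< ½ ℚ.* ε
    half p q 0<P PQ≡½ε p≤P q<Q = subst (ℚ._< ½ ℚ.* ε) (sym (ℚ.∣p*q∣≡∣p∣*∣q∣ p q))
      (subst (ℚ.∣ p ∣ ℚ.* ℚ.∣ q ∣ ℚ.<_) PQ≡½ε (*-mono-≤-< (ℚ.0≤∣p∣ q) 0<P p≤P q<Q))

abstract
  *-cauchy : ∀ x y → IsCauchy (λ n → seq x n ℚ.* seq y n)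
  *-cauchy x y ε 0<ε =
    let A , 0<A , K , x≤A = bounded x
        B , 0<B , L , y≤B = bounded y
        η , 0<η , Aη≡½ε   = shrink 0<A (0<½ε 0<ε)
        θ , 0<θ , Bθ≡½ε   = shrink 0<B (0<½ε 0<ε)
        M , closeʸ        = cauchy y η 0<η
        N , closeˣ        = cauchy x θ 0<θ
    in (K ℕ.⊔ L) ℕ.⊔ (M ℕ.⊔ N) , λ m n ≤m ≤n →
      let KL≤m = ℕ.m⊔n≤o⇒m≤o (K ℕ.⊔ L) (M ℕ.⊔ N) ≤m
          KL≤n = ℕ.m⊔n≤o⇒m≤o (K ℕ.⊔ L) (M ℕ.⊔ N) ≤n
          MN≤m = ℕ.m⊔n≤o⇒n≤o (K ℕ.⊔ L) (M ℕ.⊔ N) ≤m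
          MN≤n = ℕ.m⊔n≤o⇒n≤o (K ℕ.⊔ L) (M ℕ.⊔ N) ≤n
      in product-close {b = seq y m} {c = seq x n} 0<A 0<B Aη≡½ε Bθ≡½ε
        (x≤A m (ℕ.m⊔n≤o⇒m≤o K L KL≤m))
        (y≤B n (ℕ.m⊔n≤o⇒n≤o K L KL≤n))
        (closeʸ m n (ℕ.m⊔n≤o⇒m≤o M N MN≤m) (ℕ.m⊔n≤o⇒m≤o M N MN≤n))
        (closeˣ m n (ℕ.m⊔n≤o⇒n≤o M N MN≤m) (ℕ.m⊔n≤o⇒n≤o M N MN≤n))

_*_ : ℝ → ℝ → ℝ
x * y = mkℝ (λ n → seq x n ℚ.* seq y n) (*-cauchy x y)

-- The value 0 at 0 is immaterial: a sequence representing a real apart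
-- from 0 is eventually bounded away from 0.
recip : ℚ → ℚ
recip q with q ℚ.≟ 0ℚ
... | yes _   = 0ℚ
... | no  q≢0 = (ℚ.1/ q) {{ℚ.≢-nonZero q≢0}}

private
  *-recip : ∀ q → q ≢ 0ℚ → q ℚ.* recip q ≡ 1ℚ
  *-recip q q≢0 with q ℚ.≟ 0ℚ
  ... | yes q≡0  = contradiction q≡0 q≢0
  ... | no  q≢0′ = ℚ.*-inverseʳ q {{ℚ.≢-nonZero q≢0′}}

  0<p*p : ∀ {p} → 0ℚ ℚ.< p → 0ℚ ℚ.< p ℚ.* p
  0<p*p {p} 0<p = subst (ℚ._< p ℚ.* p) (ℚ.*-zeroʳ p)
    (ℚ.*-monoʳ-<-pos p {{ℚ.positive 0<p}} 0<p)

  awayFrom0 : ∀ x → x # 0ℝ →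
    ∃[ δ ] 0ℚ ℚ.< δ × ∃[ N ] ∀ n → N ℕ.≤ n → δ ℚ.≤ ℚ.∣ seq x n ∣
  awayFrom0 x (inj₁ (mk< δ 0<δ (N , x+δ≤0))) = δ , 0<δ , N , λ n N≤n →
    subst (δ ℚ.≤_) (trans (sym (ℚ.0≤p⇒∣p∣≡p (0≤-x n N≤n))) (ℚ.∣-p∣≡∣p∣ (seq x n))) (δ≤-x n N≤n)
    where
    cancel : ∀ p q → (p ℚ.+ q) ℚ.- p ≡ q
    cancel = Ring.solve 2 (λ p q → (p Ring.:+ q) Ring.:- p Ring.:= q) refl
    δ≤-x : ∀ n → N ℕ.≤ n → δ ℚ.≤ ℚ.- seq x n
    δ≤-x n N≤n = subst (δ ℚ.≤_) (ℚ.+-identityˡ (ℚ.- seq x n))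
      (subst (ℚ._≤ 0ℚ ℚ.- seq x n) (cancel (seq x n) δ)
        (ℚ.+-monoˡ-≤ (ℚ.- seq x n) (x+δ≤0 n N≤n)))
    0≤-x : ∀ n → N ℕ.≤ n → 0ℚ ℚ.≤ ℚ.- seq x n
    0≤-x n N≤n = ℚ.≤-trans (ℚ.<⇒≤ 0<δ) (δ≤-x n N≤n)
  awayFrom0 x (inj₂ (mk< δ 0<δ (N , 0+δ≤x))) = δ , 0<δ , N , λ n N≤n →
    subst (δ ℚ.≤_) (sym (ℚ.0≤p⇒∣p∣≡p (ℚ.≤-trans (ℚ.<⇒≤ 0<δ) (δ≤x n N≤n)))) (δ≤x n N≤n)
    where
    δ≤x : ∀ n → N ℕ.≤ n → δ ℚ.≤ seq x n
    δ≤x n N≤n = subst (ℚ._≤ seq x n) (ℚ.+-identityˡ δ) (0+δ≤x n N≤n)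

  recip-bound : ∀ {δ D} p → 0ℚ ℚ.< δ → δ ℚ.* D ≡ 1ℚ → δ ℚ.≤ ℚ.∣ p ∣ →
                p ≢ 0ℚ × ℚ.∣ recip p ∣ ℚ.≤ D
  recip-bound {δ} {D} p 0<δ δD≡1 δ≤∣p∣ = p≢0 ,
    ℚ.*-cancelˡ-≤-pos δ {{ℚ.positive 0<δ}} (subst (δ ℚ.* ℚ.∣ recip p ∣ ℚ.≤_)
      (trans (sym (ℚ.∣p*q∣≡∣p∣*∣q∣ p (recip p)))
        (trans (cong ℚ.∣_∣ (*-recip p p≢0)) (sym δD≡1)))
      (ℚ.*-monoʳ-≤-nonNeg ℚ.∣ recip p ∣ {{ℚ.nonNegative (ℚ.0≤∣p∣ (recip p))}} δ≤∣p∣))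
    where
    p≢0 : p ≢ 0ℚ
    p≢0 p≡0 = ℚ.<-irrefl refl (ℚ.<-≤-trans 0<δ (subst (λ t → δ ℚ.≤ ℚ.∣ t ∣) p≡0 δ≤∣p∣))

  recip-close : ∀ {δ D ε η} a b → 0ℚ ℚ.< δ → 0ℚ ℚ.< D → δ ℚ.* D ≡ 1ℚ →
    (D ℚ.* D) ℚ.* η ≡ ε → δ ℚ.≤ ℚ.∣ a ∣ → δ ℚ.≤ ℚ.∣ b ∣ → ℚ.∣ b ℚ.- a ∣ ℚ.< η →
    ℚ.∣ recip a ℚ.- recip b ∣ ℚ.< ε
  recip-close {δ} {D} {ε} {η} a b 0<δ 0<D δD≡1 DDη≡ε δ≤∣a∣ δ≤∣b∣ b-a<η =
    subst (λ t → ℚ.∣ t ∣ ℚ.< ε)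
      (sym (regroup (recip a) (recip b) (*-recip a a≢0) (*-recip b b≢0)))
      (subst (ℚ._< ε) (sym (ℚ.∣p*q∣≡∣p∣*∣q∣ (recip a ℚ.* recip b) (b ℚ.- a)))
        (subst (ℚ.∣ recip a ℚ.* recip b ∣ ℚ.* ℚ.∣ b ℚ.- a ∣ ℚ.<_) DDη≡ε
          (*-mono-≤-< (ℚ.0≤∣p∣ (b ℚ.- a)) (0<p*p 0<D) rs≤DD b-a<η)))
    where
    a≢0 : a ≢ 0ℚ
    a≢0 = proj₁ (recip-bound a 0<δ δD≡1 δ≤∣a∣)
    b≢0 : b ≢ 0ℚ
    b≢0 = proj₁ (recip-bound b 0<δ δD≡1 δ≤∣b∣)
    rs≤DD : ℚ.∣ recip a ℚ.* recip b ∣ ℚ.≤ D ℚ.* D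
    rs≤DD = subst (ℚ._≤ D ℚ.* D) (sym (ℚ.∣p*q∣≡∣p∣*∣q∣ (recip a) (recip b)))
      (*-mono-≤ (ℚ.0≤∣p∣ (recip b)) (ℚ.<⇒≤ 0<D)
        (proj₂ (recip-bound a 0<δ δD≡1 δ≤∣a∣)) (proj₂ (recip-bound b 0<δ δD≡1 δ≤∣b∣)))
    expand : ∀ a b r s → (r ℚ.* s) ℚ.* (b ℚ.- a) ≡ r ℚ.* (b ℚ.* s) ℚ.- s ℚ.* (a ℚ.* r)
    expand = Ring.solve 4 (λ a b r s → (r Ring.:* s) Ring.:* (b Ring.:- a) Ring.:=
      r Ring.:* (b Ring.:* s) Ring.:- s Ring.:* (a Ring.:* r)) refl
    regroup : ∀ r s → a ℚ.* r ≡ 1ℚ → b ℚ.* s ≡ 1ℚ → r ℚ.- s ≡ (r ℚ.* s) ℚ.* (b ℚ.- a)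
    regroup r s ar≡1 bs≡1 = sym (trans (expand a b r s)
      (cong₂ ℚ._-_ (trans (cong (r ℚ.*_) bs≡1) (ℚ.*-identityʳ r))
                   (trans (cong (s ℚ.*_) ar≡1) (ℚ.*-identityʳ s))))

abstract
  recip-cauchy : ∀ x → x # 0ℝ → IsCauchy (recip ∘ seq x)
  recip-cauchy x x#0 ε 0<ε =
    let δ , 0<δ , K , δ≤∣x∣ = awayFrom0 x x#0
        D , 0<D , δD≡1      = shrink 0<δ (ℚ.positive⁻¹ 1ℚ)
        η , 0<η , DDη≡ε     = shrink (0<p*p 0<D) 0<ε
        N , closeˣ          = cauchy x η 0<η
    in K ℕ.⊔ N , λ m n ≤m ≤n →
      recip-close (seq x m) (seq x n) 0<δ 0<D δD≡1 DDη≡ε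
        (δ≤∣x∣ m (ℕ.m⊔n≤o⇒m≤o K N ≤m)) (δ≤∣x∣ n (ℕ.m⊔n≤o⇒m≤o K N ≤n))
        (closeˣ n m (ℕ.m⊔n≤o⇒n≤o K N ≤n) (ℕ.m⊔n≤o⇒n≤o K N ≤m))

inverse : ∀ x → x # 0ℝ → ℝ
inverse x x#0 = mkℝ (recip ∘ seq x) (recip-cauchy x x#0)

ℝ-rawRing : RawRing 0ℓ 0ℓ
ℝ-rawRing = record
  { Carrier = ℝ
  ; _≈_     = _≈_
  ; _+_     = _+_
  ; _*_     = _*_
  ; -_      = -_
  ; 0#      = 0ℝ
  ; 1#      = 1ℝ
  }

open import Algebra.Definitions.RawSemiring (RawRing.rawSemiring ℝ-rawRing) public
  using (sum; product; _^_)

Matrix : ℕ → Set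
Matrix n = Fin n → Fin n → ℝ

-- Laplace expansion along the first row
det : ∀ {n} → Matrix n → ℝ
det {zero}  M = 1ℝ
det {suc n} M = sum λ j →
  (- 1ℝ) ^ toℕ j * M zero j * det (λ a b → M (suc a) (punchIn j b))

identity : ∀ {n} → Matrix n
identity i j with i Fin.≟ j
... | yes _ = 1ℝ
... | no  _ = 0ℝ

charPoly : ∀ {n} → Matrix n → ℝ → ℝ
charPoly A x = det (λ i j → x * identity i j - A i j)

-- γ lists the eigenvalues of A in non-increasing order, each repeated
-- according to its multiplicity as a root of the characteristic polynomial.
-- A real symmetric matrix has such a list, unique up to _≈_.
record IsSpectrum {n} (A : Matrix n) (γ : Fin n → ℝ) : Set where
  field
    factors   : ∀ x → charPoly A x ≈ product (λ i → x - γ i)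
    decreases : ∀ i j → i Fin.≤ j → γ j ≤ γ i

IsSecondLargestEigenvalue : ∀ {n} → Matrix n → ℝ → Set
IsSecondLargestEigenvalue {n} A γ₂ =
  ∃[ γ ] IsSpectrum A γ × ∃[ i ] toℕ {n} i ≡ 1 × γ₂ ≈ γ i

record Graph (v : ℕ) : Set₁ where
  infix 4 _~_ _~?_
  field
    _~_    : Rel (Fin v) 0ℓ
    _~?_   : Decidable _~_
    ~-sym  : Symmetric _~_
    ~-irr  : ∀ {i} → ¬ (i ~ i)

  neighbours : Fin v → List (Fin v)
  neighbours i = filter (i ~?_) (allFin v)

  degree : Fin v → ℕ
  degree i = length (neighbours i)

  edgeDegree : Fin v × Fin v → ℕ
  edgeDegree (i , j) = length (filter (λ h → (i ~? h) ×-dec (j ~? h)) (allFin v))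

  -- Each edge occurs in both orientations.
  edges : List (Fin v × Fin v)
  edges = filter (λ (i , j) → i ~? j) (cartesianProduct (allFin v) (allFin v))

  -- The first argument of min and max is the value for the empty list.
  -- Degrees and edge-degrees lie between 0 and v, so the values below are
  -- the true extrema as soon as the graph has an edge.
  δ Δ λmin λmax : ℕ
  δ    = min v (map degree (allFin v))
  Δ    = max 0 (map degree (allFin v))
  λmin = min v (map edgeDegree edges)
  λmax = max 0 (map edgeDegree edges)

  HasEdge : Set
  HasEdge = ∃₂ _~_

  IsRegular : ℕ → Set
  IsRegular d = ∀ i → degree i ≡ d

  adjacency : Matrix v
  adjacency i j with i ~? j
  ... | yes _ = 1ℝ
  ... | no  _ = 0ℝ

open Graph public
  using (HasEdge; IsRegular; adjacency; degree; edgeDegree; edges; δ; Δ; λmin; λmax)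

-- j follows i in the cyclic order on Fin n
Next : ∀ {n} → Rel (Fin n) 0ℓ
Next {n} i j = toℕ j ≡ suc (toℕ i) ⊎ (suc (toℕ i) ≡ n × toℕ j ≡ 0)

-- For n ≥ 3 the clause i ≢ j is automatic; it only removes the loop that
-- would otherwise appear for n = 1.
cycle : ∀ n → Graph n
cycle n = record
  { _~_   = λ i j → i ≢ j × (Next i j ⊎ Next j i)
  ; _~?_  = λ i j → ¬? (i Fin.≟ j) ×-dec (next? i j ⊎-dec next? j i)
  ; ~-sym = λ (i≢j , next) → i≢j ∘ sym , swap next
  ; ~-irr = λ (i≢i , _) → i≢i refl
  }
  where
  next? : Decidable (Next {n})
  next? i j = (toℕ j ℕ.≟ suc (toℕ i)) ⊎-dec
              ((suc (toℕ i) ℕ.≟ n) ×-dec (toℕ j ℕ.≟ 0))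

-- The vertex p of the product stands for the pair remQuot n p.
infixl 7 _□_
_□_ : ∀ {m n} → Graph m → Graph n → Graph (m ℕ.* n)
_□_ {m} {n} G H = record
  { _~_   = λ p q → remQuot n p ~ₚ remQuot n q
  ; _~?_  = λ p q → remQuot n p ~ₚ? remQuot n q
  ; ~-sym = λ { (inj₁ (a≡c , b~d)) → inj₁ (sym a≡c , H.~-sym b~d)
              ; (inj₂ (b≡d , a~c)) → inj₂ (sym b≡d , G.~-sym a~c) }
  ; ~-irr = [ H.~-irr ∘ proj₂ , G.~-irr ∘ proj₂ ]
  }
  where
  module G = Graph G
  module H = Graph H

  infix 4 _~ₚ_ _~ₚ?_
  _~ₚ_ : Rel (Fin m × Fin n) 0ℓ
  (a , b) ~ₚ (c , d) = (a ≡ c × b H.~ d) ⊎ (b ≡ d × a G.~ c)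

  _~ₚ?_ : Decidable _~ₚ_
  (a , b) ~ₚ? (c , d) = ((a Fin.≟ c) ×-dec (b H.~? d)) ⊎-dec ((b Fin.≟ d) ×-dec (a G.~? c))

CA : (v : ℕ) (x : ℤ) (s : ℕ) (κ l : ℝ) → ℝ
CA v x s κ l =
    X * (X + 1ℝ) * (fromℕ v - S)
  - fromℕ 2 * X * S * (κ - S + 1ℝ)
  + S * (S - 1ℝ) * (l - S + fromℕ 2)
  where
  X = fromℤ x
  S = fromℕ s

RulesOutCliques : ∀ {v} → Graph v → ℕ → Set
RulesOutCliques {v} G s = ∀ (κ l : ℝ) →
  fromℕ (δ G) ≤ κ → κ ≤ fromℕ (Δ G) →
  fromℕ (λmin G) ≤ l → l ≤ fromℕ (λmax G) →
  ∃[ x ] CA v x s κ l < 0ℝ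

-- b is the least value of s - 1 over the positive integers s = suc t
-- satisfying RulesOutCliques G s.
record IsGeneralisedCAPBound {v} (G : Graph v) (b : ℕ) : Set where
  field
    hasEdge  : HasEdge G
    attained : RulesOutCliques G (suc b)
    least    : ∀ t → RulesOutCliques G (suc t) → b ℕ.≤ t

hoffmanDenominator : (v d : ℕ) (γ₂ : ℝ) → ℝ
hoffmanDenominator v d γ₂ = fromℕ v - fromℕ d + γ₂

hoffmanBound : (v d : ℕ) (γ₂ : ℝ) → hoffmanDenominator v d γ₂ # 0ℝ → ℝ
hoffmanBound v d γ₂ den#0 =
  fromℕ v * (1ℝ + γ₂) * inverse (hoffmanDenominator v d γ₂) den#0

{-# OPTIONS --safe #-}

-- Write d = k + 2 for the degree and γ for the second largest eigenvalue.
-- At x = 0 the polynomial CA is s (s - 1) (λ - s + 2), so s = d + 1 rules out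
-- cliques as soon as λmax < d - 1; this holds because the two neighbours of a
-- vertex p along the cycle are not adjacent to any neighbour of p.  Hence the
-- CAP bound is at most d.  Since v (1 + γ) - d (v - d + γ) equals
-- (v - d) (γ - (d - 1)) + d, the Hoffman bound exceeds d once γ > d - 1.
--
-- For the latter, every real t = 2 cos (2πj/n) gives an eigenvalue k + t, and
-- so does t = 2.  If some t ≠ 2 of this form exceeds 1 and γ were at most d - 1,
-- the characteristic polynomial would have two different roots above γ.  Such a
-- t is a zero of a Chebyshev polynomial, found by bisection between 2 and a
-- rational point where the polynomial is negative; the angle doubling formulas
-- provide that point for every large n.
module Submission where

open import Defs
open import Data.Nat.Base using (ℕ)
open import Data.Product.Base using (Σ-syntax; ∃-syntax)
import Data.Nat.Base as ℕ
open import Algebra.Bundles using (CommutativeRing)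
open import Data.Fin.Base as Fin
  using (Fin; zero; suc; toℕ; fromℕ<; inject₁; punchIn; combine; remQuot; _↑ˡ_; _↑ʳ_)
open import Data.Fin.Induction using (<-weakInduction)
open import Data.Fin.Permutation using (Permutation; permutation)
import Data.Fin.Properties as Fin
open import Data.Integer.Base as ℤ using (+_; +[1+_]; -[1+_])
import Data.Integer.Properties as ℤ
open import Data.List.Base
  using (List; []; _∷_; length; filter; tabulate; allFin; map; cartesianProduct)
import Data.List.Extrema.Nat as Extrema
open import Data.List.Membership.Propositional using (lose)
open import Data.List.Membership.Propositional.Properties using (∈-allFin; ∈-filter⁺)
open import Data.List.Properties using (filter-notAll)
import Data.List.Relation.Unary.All as All
import Data.List.Relation.Unary.All.Properties as All
open import Data.Nat.Base using (zero; suc)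
open import Data.Nat.Coprimality as Coprime using (1-coprimeTo)
open import Data.Nat.Induction using (<-rec)
import Data.Nat.Properties as ℕ
open import Data.Product.Base using (_×_; _,_; proj₁; proj₂)
open import Data.Rational.Base as ℚ using (ℚ; mkℚ; 0ℚ; 1ℚ; ½)
import Data.Rational.Properties as ℚ
open import Data.Rational.Solver using (module +-*-Solver)
open import Data.Sum.Base as Sum using (_⊎_; inj₁; inj₂)
open import Function.Base using (_∘_)
open import Level using (0ℓ)
open import Relation.Binary.Definitions using (tri<; tri≈; tri>)
open import Relation.Binary.PropositionalEquality
  using (_≡_; _≢_; refl; sym; trans; cong; cong₂; subst; subst₂; module ≡-Reasoning)
import Relation.Binary.Reasoning.Setoid
open import Relation.Nullary.Decidable using (Dec; yes; no; from-yes; _×-dec_; _⊎-dec_; ¬?)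
open import Relation.Nullary.Negation using (¬_; contradiction)
open import Relation.Unary using (Pred; Decidable)

open +-*-Solver using (solve; _:+_; _:*_; _:-_; :-_; con; _:=_)

-- Cauchy reals

-- All that is known of the second eigenvalue is its place at index 1 of an ordered list whose
-- linear factors multiply to the characteristic polynomial. A lower bound for it has to come from
-- zeros of that polynomial, so an eigenvector must be turned into a vanishing determinant, starting
-- from the Laplace expansion. The eigenvectors depend on the cycle coordinate j alone, with value
-- `U t (suc j)`; the shift makes the value at vertex 0 equal to 1, so that no division by a
-- coordinate is needed. Order and equality of Cauchy reals are not decidable, and this shapes the
-- analysis. Bisection tests signs at rational points only, and `<-cotrans` replaces case
-- distinctions. It needs a strict gap, hence the rational lower bound `t₀` in place of the
-- condition t > 1. The angle φ with t = 2 cos φ is never constructed: sine identities become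
-- polynomial identities between values of `Uℚ`, carried to the reals term by term. The root k + 2
-- belongs to the constant vector, and t = 2 is excluded because `U 2ℝ n` is n, not 0.

p≤q⇒0≤q-p : ∀ {p q} → p ℚ.≤ q → 0ℚ ℚ.≤ q ℚ.- p
p≤q⇒0≤q-p {p} {q} p≤q = subst (ℚ._≤ q ℚ.- p) (ℚ.+-inverseʳ p) (ℚ.+-monoˡ-≤ (ℚ.- p) p≤q)

p≤p+q : ∀ p {q} → 0ℚ ℚ.≤ q → p ℚ.≤ p ℚ.+ q
p≤p+q p {q} 0≤q = subst (ℚ._≤ p ℚ.+ q) (ℚ.+-identityʳ p) (ℚ.+-monoʳ-≤ p 0≤q)

0≤p+q : ∀ {p q} → 0ℚ ℚ.≤ p → 0ℚ ℚ.≤ q → 0ℚ ℚ.≤ p ℚ.+ q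
0≤p+q {p} {q} 0≤p 0≤q = ℚ.≤-trans 0≤p (p≤p+q p 0≤q)

0<p*q : ∀ {p q} → 0ℚ ℚ.< p → 0ℚ ℚ.< q → 0ℚ ℚ.< p ℚ.* q
0<p*q {p} {q} 0<p 0<q = ℚ.positive⁻¹ _ {{ℚ.pos*pos⇒pos p {{ℚ.positive 0<p}} q {{ℚ.positive 0<q}}}}

0≤p*q : ∀ {p q} → 0ℚ ℚ.≤ p → 0ℚ ℚ.≤ q → 0ℚ ℚ.≤ p ℚ.* q
0≤p*q {p} {q} 0≤p 0≤q =
  ℚ.nonNegative⁻¹ _ {{ℚ.nonNeg*nonNeg⇒nonNeg p {{ℚ.nonNegative 0≤p}} q {{ℚ.nonNegative 0≤q}}}}

0<½p : ∀ {p} → 0ℚ ℚ.< p → 0ℚ ℚ.< ½ ℚ.* p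
0<½p = 0<p*q (ℚ.positive⁻¹ ½)

p≤∣p∣ : ∀ p → p ℚ.≤ ℚ.∣ p ∣
p≤∣p∣ p with ℚ.≤-total 0ℚ p
... | inj₁ 0≤p = ℚ.≤-reflexive (sym (ℚ.0≤p⇒∣p∣≡p 0≤p))
... | inj₂ p≤0 = ℚ.≤-trans p≤0 (ℚ.0≤∣p∣ p)

∣p∣<ε : ∀ {p ε} → p ℚ.< ε → ℚ.- p ℚ.< ε → ℚ.∣ p ∣ ℚ.< ε
∣p∣<ε {p} {ε} p<ε -p<ε with ℚ.∣p∣≡p∨∣p∣≡-p p
... | inj₁ eq = subst (ℚ._< ε) (sym eq) p<ε
... | inj₂ eq = subst (ℚ._< ε) (sym eq) -p<ε

∣p-q∣<ε⇒p<q+ε : ∀ {p q ε} → ℚ.∣ p ℚ.- q ∣ ℚ.< ε → p ℚ.< q ℚ.+ ε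
∣p-q∣<ε⇒p<q+ε {p} {q} {ε} h = subst (ℚ._< q ℚ.+ ε)
  (solve 2 (λ p q → q :+ (p :- q) := p) refl p q)
  (ℚ.+-monoʳ-< q (ℚ.≤-<-trans (p≤∣p∣ (p ℚ.- q)) h))

p<q+ε⇒p-q<ε : ∀ {p q ε} → p ℚ.< q ℚ.+ ε → p ℚ.- q ℚ.< ε
p<q+ε⇒p-q<ε {p} {q} {ε} h = subst (p ℚ.- q ℚ.<_)
  (solve 2 (λ q ε → (q :+ ε) :- q := ε) refl q ε)
  (ℚ.+-monoˡ-< (ℚ.- q) h)

∣p-q∣<ε : ∀ {p q ε} → p ℚ.< q ℚ.+ ε → q ℚ.< p ℚ.+ ε → ℚ.∣ p ℚ.- q ∣ ℚ.< ε
∣p-q∣<ε {p} {q} {ε} p<q+ε q<p+ε = ∣p∣<ε (p<q+ε⇒p-q<ε p<q+ε)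
  (subst (ℚ._< ε) (solve 2 (λ p q → q :- p := :- (p :- q)) refl p q) (p<q+ε⇒p-q<ε q<p+ε))

Eventually : (ℕ → Set) → Set
Eventually P = ∃[ N ] ∀ n → N ℕ.≤ n → P n

always : ∀ {P : ℕ → Set} → (∀ n → P n) → Eventually P
always p = 0 , λ n _ → p n

infixl 4 _∩_
_∩_ : ∀ {P Q : ℕ → Set} → Eventually P → Eventually Q → Eventually (λ n → P n × Q n)
(M , p) ∩ (N , q) = M ℕ.⊔ N , λ n ≤n →
  p n (ℕ.m⊔n≤o⇒m≤o M N ≤n) , q n (ℕ.m⊔n≤o⇒n≤o M N ≤n)

eventually-map : ∀ {P Q : ℕ → Set} → (∀ n → P n → Q n) → Eventually P → Eventually Q
eventually-map f (N , p) = N , λ n ≤n → f n (p n ≤n)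

eventually-common : ∀ {P : ℕ → Set} → Eventually P → ∃[ n ] P n
eventually-common (N , p) = N , p N ℕ.≤-refl

cauchy-≤ : ∀ x {ε} → 0ℚ ℚ.< ε → ∃[ N ] ∀ m n → N ℕ.≤ m → N ℕ.≤ n → seq x m ℚ.≤ seq x n ℚ.+ ε
cauchy-≤ x 0<ε = let N , h = cauchy x _ 0<ε in
  N , λ m n ≤m ≤n → ℚ.<⇒≤ (∣p-q∣<ε⇒p<q+ε (h m n ≤m ≤n))

≈⇒≤+ : ∀ {x y} → x ≈ y → ∀ {ε} → 0ℚ ℚ.< ε → Eventually (λ n → seq x n ℚ.< seq y n ℚ.+ ε)
≈⇒≤+ (mk≈ h) 0<ε = eventually-map (λ n → ∣p-q∣<ε⇒p<q+ε) (h _ 0<ε)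

pointwise : ∀ {x y} → (∀ n → seq x n ≡ seq y n) → x ≈ y
pointwise {x} {y} h = mk≈ λ ε 0<ε → 0 , λ n _ → subst (ℚ._< ε)
  (sym (cong ℚ.∣_∣ (trans (cong (ℚ._- seq y n) (h n)) (ℚ.+-inverseʳ (seq y n))))) 0<ε

≈-refl : ∀ {x} → x ≈ x
≈-refl = pointwise λ _ → refl

≈-sym : ∀ {x y} → x ≈ y → y ≈ x
≈-sym {x} {y} (mk≈ h) = mk≈ λ ε 0<ε → let N , f = h ε 0<ε in
  N , λ n ≤n → subst (ℚ._< ε) (flip (seq x n) (seq y n)) (f n ≤n)
  where
  flip : ∀ p q → ℚ.∣ p ℚ.- q ∣ ≡ ℚ.∣ q ℚ.- p ∣
  flip p q = trans (sym (ℚ.∣-p∣≡∣p∣ (p ℚ.- q)))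
    (cong ℚ.∣_∣ (solve 2 (λ p q → :- (p :- q) := q :- p) refl p q))

½+½ : ∀ p ε → (p ℚ.+ ½ ℚ.* ε) ℚ.+ ½ ℚ.* ε ≡ p ℚ.+ ε
½+½ = solve 2 (λ p ε → (p :+ con ½ :* ε) :+ con ½ :* ε := p :+ ε) refl

≈-trans : ∀ {x y z} → x ≈ y → y ≈ z → x ≈ z
≈-trans {x} {y} {z} p q = mk≈ λ ε 0<ε → eventually-map
  (λ n ((xy , yx) , (yz , zy)) → ∣p-q∣<ε (chain (seq x n) (seq z n) xy yz) (chain (seq z n) (seq x n) zy yx))
  ((≈⇒≤+ p (0<½p 0<ε) ∩ ≈⇒≤+ (≈-sym p) (0<½p 0<ε)) ∩ (≈⇒≤+ q (0<½p 0<ε) ∩ ≈⇒≤+ (≈-sym q) (0<½p 0<ε)))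
  where
  chain : ∀ a c {b ε} → a ℚ.< b ℚ.+ ½ ℚ.* ε → b ℚ.< c ℚ.+ ½ ℚ.* ε → a ℚ.< c ℚ.+ ε
  chain a c {b} {ε} ab bc = ℚ.<-trans ab
    (subst (b ℚ.+ ½ ℚ.* ε ℚ.<_) (½+½ c ε) (ℚ.+-monoˡ-< (½ ℚ.* ε) bc))

bounded : ∀ x → ∃[ B ] 0ℚ ℚ.< B × Eventually (λ n → ℚ.∣ seq x n ∣ ℚ.≤ B)
bounded x with cauchy x 1ℚ (ℚ.positive⁻¹ 1ℚ)
... | N , close = B , 0<B , N , λ n ≤n → ℚ.≤-trans
      (subst (λ t → ℚ.∣ t ∣ ℚ.≤ ℚ.∣ seq x n ℚ.- seq x N ∣ ℚ.+ ℚ.∣ seq x N ∣)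
        (solve 2 (λ p q → (p :- q) :+ q := p) refl (seq x n) (seq x N))
        (ℚ.∣p+q∣≤∣p∣+∣q∣ (seq x n ℚ.- seq x N) (seq x N)))
      (ℚ.+-monoˡ-≤ ℚ.∣ seq x N ∣ (ℚ.<⇒≤ (close n N ≤n ℕ.≤-refl)))
  where
  B = 1ℚ ℚ.+ ℚ.∣ seq x N ∣
  0<B : 0ℚ ℚ.< B
  0<B = ℚ.<-≤-trans (ℚ.positive⁻¹ 1ℚ) (p≤p+q 1ℚ (ℚ.0≤∣p∣ (seq x N)))

divide : ∀ {A ε} → 0ℚ ℚ.< A → 0ℚ ℚ.< ε → ∃[ η ] 0ℚ ℚ.< η × A ℚ.* η ≡ ε
divide {A} {ε} 0<A 0<ε = 1/A ℚ.* ε , 0<p*q (ℚ.positive⁻¹ 1/A {{ℚ.1/pos⇒pos A}}) 0<ε ,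
  trans (sym (ℚ.*-assoc A 1/A ε)) (trans (cong (ℚ._* ε) (ℚ.*-inverseʳ A)) (ℚ.*-identityˡ ε))
  where
  instance
    A-pos : ℚ.Positive A
    A-pos = ℚ.positive 0<A
    A-nonZero : ℚ.NonZero A
    A-nonZero = ℚ.pos⇒nonZero A
  1/A = ℚ.1/ A

+-cong : ∀ {x x′ y y′} → x ≈ x′ → y ≈ y′ → x + y ≈ x′ + y′
+-cong {x} {x′} {y} {y′} p q = mk≈ λ ε 0<ε → eventually-map
  (λ n ((xx′ , x′x) , (yy′ , y′y)) → ∣p-q∣<ε
    (add (seq x n) (seq y n) (seq x′ n) (seq y′ n) xx′ yy′)
    (add (seq x′ n) (seq y′ n) (seq x n) (seq y n) x′x y′y))
  ((≈⇒≤+ p (0<½p 0<ε) ∩ ≈⇒≤+ (≈-sym p) (0<½p 0<ε)) ∩ (≈⇒≤+ q (0<½p 0<ε) ∩ ≈⇒≤+ (≈-sym q) (0<½p 0<ε)))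
  where
  add : ∀ a b c d {ε} → a ℚ.< c ℚ.+ ½ ℚ.* ε → b ℚ.< d ℚ.+ ½ ℚ.* ε → a ℚ.+ b ℚ.< (c ℚ.+ d) ℚ.+ ε
  add a b c d {ε} ac bd = subst (a ℚ.+ b ℚ.<_)
    (solve 3 (λ c d ε → (c :+ con ½ :* ε) :+ (d :+ con ½ :* ε) := (c :+ d) :+ ε) refl c d ε)
    (ℚ.+-mono-< ac bd)

neg-cong : ∀ {x y} → x ≈ y → - x ≈ - y
neg-cong {x} {y} (mk≈ h) = mk≈ λ ε 0<ε → let N , f = h ε 0<ε in
  N , λ n ≤n → subst (ℚ._< ε) (flip (seq x n) (seq y n)) (f n ≤n)
  where
  flip : ∀ p q → ℚ.∣ p ℚ.- q ∣ ≡ ℚ.∣ (ℚ.- p) ℚ.- (ℚ.- q) ∣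
  flip p q = trans (sym (ℚ.∣-p∣≡∣p∣ (p ℚ.- q))) (cong ℚ.∣_∣ (ℚ.neg-distrib-+ p (ℚ.- q)))

*-congˡ : ∀ {x y z} → y ≈ z → x * y ≈ x * z
*-congˡ {x} {y} {z} (mk≈ h) = mk≈ λ ε 0<ε →
  let B , 0<B , x≤B = bounded x
      η , 0<η , Bη≡ε = divide 0<B 0<ε
  in eventually-map (λ n (x≤B , y-z<η) → subst₂ ℚ._<_
       (trans (sym (ℚ.∣p*q∣≡∣p∣*∣q∣ (seq x n) (seq y n ℚ.- seq z n)))
         (cong ℚ.∣_∣ (solve 3 (λ x y z → x :* (y :- z) := x :* y :- x :* z) refl (seq x n) (seq y n) (seq z n))))
       Bη≡ε
       (ℚ.≤-<-trans
         (ℚ.*-monoʳ-≤-nonNeg _ {{ℚ.nonNegative (ℚ.0≤∣p∣ (seq y n ℚ.- seq z n))}} x≤B)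
         (ℚ.*-monoʳ-<-pos B {{ℚ.positive 0<B}} y-z<η)))
     (x≤B ∩ h η 0<η)

*-comm : ∀ x y → x * y ≈ y * x
*-comm x y = pointwise λ n → ℚ.*-comm (seq x n) (seq y n)

*-cong : ∀ {x x′ y y′} → x ≈ x′ → y ≈ y′ → x * y ≈ x′ * y′
*-cong {x} {x′} {y} {y′} p q = ≈-trans (*-congˡ {x} q)
  (≈-trans (*-comm x y′) (≈-trans (*-congˡ {y′} p) (*-comm y′ x′)))

ℝ-commutativeRing : CommutativeRing 0ℓ 0ℓ
ℝ-commutativeRing = record
  { Carrier = ℝ ; _≈_ = _≈_ ; _+_ = _+_ ; _*_ = _*_ ; -_ = -_ ; 0# = 0ℝ ; 1# = 1ℝ
  ; isCommutativeRing = record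
    { isRing = record
      { +-isAbelianGroup = record
        { isGroup = record
          { isMonoid = record
            { isSemigroup = record
              { isMagma = record
                { isEquivalence = record { refl = ≈-refl ; sym = ≈-sym ; trans = ≈-trans }
                ; ∙-cong = +-cong }
              ; assoc = λ x y z → pointwise λ n → ℚ.+-assoc (seq x n) (seq y n) (seq z n) }
            ; identity = (λ x → pointwise λ n → ℚ.+-identityˡ (seq x n))
                       , (λ x → pointwise λ n → ℚ.+-identityʳ (seq x n)) }
          ; inverse = (λ x → pointwise λ n → ℚ.+-inverseˡ (seq x n))
                    , (λ x → pointwise λ n → ℚ.+-inverseʳ (seq x n))
          ; ⁻¹-cong = neg-cong }
        ; comm = λ x y → pointwise λ n → ℚ.+-comm (seq x n) (seq y n) }
      ; *-cong = *-cong
      ; *-assoc = λ x y z → pointwise λ n → ℚ.*-assoc (seq x n) (seq y n) (seq z n)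
      ; *-identity = (λ x → pointwise λ n → ℚ.*-identityˡ (seq x n))
                   , (λ x → pointwise λ n → ℚ.*-identityʳ (seq x n))
      ; distrib = (λ x y z → pointwise λ n → ℚ.*-distribˡ-+ (seq x n) (seq y n) (seq z n))
                , (λ x y z → pointwise λ n → ℚ.*-distribʳ-+ (seq x n) (seq y n) (seq z n)) }
    ; *-comm = *-comm } }

module R = CommutativeRing ℝ-commutativeRing
module ≈-Reasoning = Relation.Binary.Reasoning.Setoid R.setoid

-- The strict order on the reals

<-resp-≈ : ∀ {x x′ y y′} → x ≈ x′ → y ≈ y′ → x < y → x′ < y′
<-resp-≈ {x} {x′} {y} {y′} p q (mk< g 0<g sep) = mk< (½ ℚ.* g) 0<½g
  (eventually-map (λ n ((x′x , yy′) , x+g≤y) →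
      shift (seq x n) (seq x′ n) (seq y n) (seq y′ n) (ℚ.<⇒≤ x′x) (ℚ.<⇒≤ yy′) x+g≤y)
    (≈⇒≤+ (≈-sym p) 0<η ∩ ≈⇒≤+ q 0<η ∩ sep))
  where
  0<½g = 0<½p 0<g
  -- Each side may move by a quarter of the gap, which leaves half of it.
  η = ½ ℚ.* (½ ℚ.* g)
  0<η : 0ℚ ℚ.< η
  0<η = 0<½p 0<½g
  shift : ∀ a a′ b b′ → a′ ℚ.≤ a ℚ.+ η → b ℚ.≤ b′ ℚ.+ η → a ℚ.+ g ℚ.≤ b → a′ ℚ.+ ½ ℚ.* g ℚ.≤ b′
  shift a a′ b b′ h₁ h₂ h₃ = subst (a′ ℚ.+ ½ ℚ.* g ℚ.≤_)
    (solve 5 (λ a a′ b b′ g →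
      let η = con ½ :* (con ½ :* g) in
      (a′ :+ con ½ :* g) :+ (((a :+ η) :- a′) :+ ((b′ :+ η) :- b) :+ (b :- (a :+ g))) := b′) refl a a′ b b′ g)
    (p≤p+q (a′ ℚ.+ ½ ℚ.* g) (0≤p+q (0≤p+q (p≤q⇒0≤q-p h₁) (p≤q⇒0≤q-p h₂)) (p≤q⇒0≤q-p h₃)))

-- Substitute for trichotomy. At one late index K the rational `seq z K` is compared with the point
-- halfway up the gap above `seq x K`. The gap is six times η: three η below that point and three
-- above, of which later fluctuations of x and z consume at most two, so a gap of η remains in
-- either case.
<-cotrans : ∀ {x y} → x < y → ∀ z → x < z ⊎ z < y
<-cotrans {x} {y} (mk< g 0<g (L , sep)) z = decide (ℚ.≤-total (seq z K) (seq x K ℚ.+ h))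
  where
  η+ = divide {((1ℚ ℚ.+ 1ℚ) ℚ.+ 1ℚ) ℚ.+ ((1ℚ ℚ.+ 1ℚ) ℚ.+ 1ℚ)} (ℚ.positive⁻¹ _) 0<g
  η = proj₁ η+
  h = (η ℚ.+ η) ℚ.+ η
  0<η : 0ℚ ℚ.< η
  0<η = proj₁ (proj₂ η+)
  g≡h+h : g ≡ h ℚ.+ h
  g≡h+h = trans (sym (proj₂ (proj₂ η+)))
    (solve 1 (λ η → (((con 1ℚ :+ con 1ℚ) :+ con 1ℚ) :+ ((con 1ℚ :+ con 1ℚ) :+ con 1ℚ)) :* η
      := ((η :+ η) :+ η) :+ ((η :+ η) :+ η)) refl η)
  M = proj₁ (cauchy-≤ x 0<η)
  xc = proj₂ (cauchy-≤ x 0<η)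
  N = proj₁ (cauchy-≤ z 0<η)
  zc = proj₂ (cauchy-≤ z 0<η)
  K = L ℕ.⊔ (M ℕ.⊔ N)
  L≤ : ∀ {n} → K ℕ.≤ n → L ℕ.≤ n
  L≤ = ℕ.m⊔n≤o⇒m≤o L (M ℕ.⊔ N)
  M≤ : ∀ {n} → K ℕ.≤ n → M ℕ.≤ n
  M≤ = ℕ.m⊔n≤o⇒m≤o M N ∘ ℕ.m⊔n≤o⇒n≤o L (M ℕ.⊔ N)
  N≤ : ∀ {n} → K ℕ.≤ n → N ℕ.≤ n
  N≤ = ℕ.m⊔n≤o⇒n≤o M N ∘ ℕ.m⊔n≤o⇒n≤o L (M ℕ.⊔ N)
  low : ∀ η a aₙ b c cₙ → let h = (η ℚ.+ η) ℚ.+ η in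
        a ℚ.≤ aₙ ℚ.+ η → aₙ ℚ.+ (h ℚ.+ h) ℚ.≤ b → cₙ ℚ.≤ c ℚ.+ η → c ℚ.≤ a ℚ.+ h →
        cₙ ℚ.+ η ℚ.≤ b
  low η a aₙ b c cₙ h₁ h₂ h₃ h₄ = subst (cₙ ℚ.+ η ℚ.≤_)
    (solve 6 (λ a aₙ b c cₙ η →
      let h = (η :+ η) :+ η in
      (cₙ :+ η) :+ ((((aₙ :+ η) :- a) :+ (b :- (aₙ :+ (h :+ h)))) :+ (((c :+ η) :- cₙ) :+ ((a :+ h) :- c))) := b)
      refl a aₙ b c cₙ η)
    (p≤p+q (cₙ ℚ.+ η) (0≤p+q (0≤p+q (p≤q⇒0≤q-p h₁) (p≤q⇒0≤q-p h₂))
      (0≤p+q (p≤q⇒0≤q-p h₃) (p≤q⇒0≤q-p h₄))))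
  high : ∀ η a aₙ c cₙ → let h = (η ℚ.+ η) ℚ.+ η in
         aₙ ℚ.≤ a ℚ.+ η → c ℚ.≤ cₙ ℚ.+ η → a ℚ.+ h ℚ.≤ c → aₙ ℚ.+ η ℚ.≤ cₙ
  high η a aₙ c cₙ h₁ h₂ h₃ = subst (aₙ ℚ.+ η ℚ.≤_)
    (solve 5 (λ a aₙ c cₙ η →
      (aₙ :+ η) :+ ((((a :+ η) :- aₙ) :+ ((cₙ :+ η) :- c)) :+ (c :- (a :+ ((η :+ η) :+ η)))) := cₙ)
      refl a aₙ c cₙ η)
    (p≤p+q (aₙ ℚ.+ η) (0≤p+q (0≤p+q (p≤q⇒0≤q-p h₁) (p≤q⇒0≤q-p h₂)) (p≤q⇒0≤q-p h₃)))
  decide : seq z K ℚ.≤ seq x K ℚ.+ h ⊎ seq x K ℚ.+ h ℚ.≤ seq z K → x < z ⊎ z < y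
  decide (inj₁ z≤) = inj₂ (mk< η 0<η (K , λ n ≤n →
    low η (seq x K) (seq x n) (seq y n) (seq z K) (seq z n)
      (xc K n (M≤ ℕ.≤-refl) (M≤ ≤n)) (subst (λ t → seq x n ℚ.+ t ℚ.≤ seq y n) g≡h+h (sep n (L≤ ≤n)))
      (zc n K (N≤ ≤n) (N≤ ℕ.≤-refl)) z≤))
  decide (inj₂ ≤z) = inj₁ (mk< η 0<η (K , λ n ≤n →
    high η (seq x K) (seq x n) (seq z K) (seq z n)
      (xc n K (M≤ ≤n) (M≤ ℕ.≤-refl)) (zc K n (N≤ ℕ.≤-refl) (N≤ ≤n)) ≤z))

-- `x ≤ y` is only a negation and carries no gap; cotransitivity of `y < z` supplies one.
≤-<-trans : ∀ {x y z} → x ≤ y → y < z → x < z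
≤-<-trans {x} {y} {z} x≤y y<z = choose (<-cotrans y<z x)
  where
  choose : y < x ⊎ x < z → x < z
  choose (inj₁ y<x) = contradiction y<x x≤y
  choose (inj₂ x<z) = x<z

<-irrefl : ∀ {x y} → x ≈ y → ¬ (x < y)
<-irrefl {x} {y} p x<y = absurd (<-resp-≈ {y′ = y} p ≈-refl x<y)
  where
  cancel : ∀ a g → a ℚ.+ g ℚ.≤ a → g ℚ.≤ 0ℚ
  cancel a g h = subst₂ ℚ._≤_ (solve 2 (λ a g → :- a :+ (a :+ g) := g) refl a g)
    (ℚ.+-inverseˡ a) (ℚ.+-monoʳ-≤ (ℚ.- a) h)
  absurd : ¬ (y < y)
  absurd (mk< g 0<g (N , sep)) =
    ℚ.<-irrefl refl (ℚ.<-≤-trans 0<g (cancel (seq y N) g (sep N ℕ.≤-refl)))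

fromℚ-mono-< : ∀ {p q} → p ℚ.< q → fromℚ p < fromℚ q
fromℚ-mono-< {p} {q} p<q = mk< (q ℚ.- p)
  (subst (ℚ._< q ℚ.- p) (ℚ.+-inverseʳ p) (ℚ.+-monoˡ-< (ℚ.- p) p<q))
  (always λ _ → ℚ.≤-reflexive (solve 2 (λ p q → p :+ (q :- p) := q) refl p q))

x<y⇒0<y-x : ∀ {x y} → x < y → 0ℝ < y - x
x<y⇒0<y-x {x} {y} (mk< g 0<g sep) = mk< g 0<g (eventually-map (λ n → move (seq x n) (seq y n)) sep)
  where
  move : ∀ a b → a ℚ.+ g ℚ.≤ b → 0ℚ ℚ.+ g ℚ.≤ b ℚ.- a
  move a b h = subst (ℚ._≤ b ℚ.- a) (solve 2 (λ a g → (a :+ g) :- a := con 0ℚ :+ g) refl a g)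
    (ℚ.+-monoˡ-≤ (ℚ.- a) h)

0<y-x⇒x<y : ∀ {x y} → 0ℝ < y - x → x < y
0<y-x⇒x<y {x} {y} (mk< g 0<g sep) = mk< g 0<g (eventually-map (λ n → move (seq x n) (seq y n)) sep)
  where
  move : ∀ a b → 0ℚ ℚ.+ g ℚ.≤ b ℚ.- a → a ℚ.+ g ℚ.≤ b
  move a b h = subst₂ ℚ._≤_ (solve 2 (λ a g → a :+ (con 0ℚ :+ g) := a :+ g) refl a g)
    (solve 2 (λ a b → a :+ (b :- a) := b) refl a b) (ℚ.+-monoʳ-≤ a h)

0<x+y : ∀ {x y} → 0ℝ < x → 0ℝ < y → 0ℝ < x + y
0<x+y {x} {y} (mk< g 0<g sepˣ) (mk< h 0<h sepʸ) = mk< (g ℚ.+ h)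
  (ℚ.<-≤-trans 0<g (p≤p+q g (ℚ.<⇒≤ 0<h)))
  (eventually-map (λ n (g≤x , h≤y) → subst (ℚ._≤ seq x n ℚ.+ seq y n)
      (solve 2 (λ g h → (con 0ℚ :+ g) :+ (con 0ℚ :+ h) := con 0ℚ :+ (g :+ h)) refl g h)
      (ℚ.+-mono-≤ g≤x h≤y))
    (sepˣ ∩ sepʸ))

0<x*y : ∀ {x y} → 0ℝ < x → 0ℝ < y → 0ℝ < x * y
0<x*y {x} {y} (mk< g 0<g sepˣ) (mk< h 0<h sepʸ) = mk< (g ℚ.* h) (0<p*q 0<g 0<h)
  (eventually-map (λ n (g≤x , h≤y) → mul (seq x n) (seq y n)
      (subst (ℚ._≤ seq x n) (ℚ.+-identityˡ g) g≤x) (subst (ℚ._≤ seq y n) (ℚ.+-identityˡ h) h≤y))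
    (sepˣ ∩ sepʸ))
  where
  mul : ∀ a b → g ℚ.≤ a → h ℚ.≤ b → 0ℚ ℚ.+ g ℚ.* h ℚ.≤ a ℚ.* b
  mul a b g≤a h≤b = subst (ℚ._≤ a ℚ.* b) (sym (ℚ.+-identityˡ (g ℚ.* h))) (ℚ.≤-trans
    (ℚ.*-monoʳ-≤-nonNeg h {{ℚ.nonNegative (ℚ.<⇒≤ 0<h)}} g≤a)
    (ℚ.*-monoˡ-≤-nonNeg a {{ℚ.nonNegative (ℚ.≤-trans (ℚ.<⇒≤ 0<g) g≤a)}} h≤b))

*-recip : ∀ q → q ≢ 0ℚ → q ℚ.* recip q ≡ 1ℚ
*-recip q q≢0 with q ℚ.≟ 0ℚ
... | yes q≡0  = contradiction q≡0 q≢0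
... | no  q≢0′ = ℚ.*-inverseʳ q {{ℚ.≢-nonZero q≢0′}}

module _ {x : ℝ} (0<x : 0ℝ < x) where

  private
    positive-tail : Eventually (λ n → 0ℚ ℚ.< seq x n)
    positive-tail = eventually-map (λ n h → ℚ.<-≤-trans
      (subst (0ℚ ℚ.<_) (sym (ℚ.+-identityˡ (_<_.gap 0<x))) (_<_.0<gap 0<x)) h) (_<_.separated 0<x)

    *-recip-tail : Eventually (λ n → seq x n ℚ.* recip (seq x n) ≡ 1ℚ)
    *-recip-tail = eventually-map
      (λ n 0<xₙ → *-recip (seq x n) λ xₙ≡0 → ℚ.<-irrefl (sym xₙ≡0) 0<xₙ) positive-tail

  *-inverse : x * inverse x (inj₂ 0<x) ≈ 1ℝ
  *-inverse = mk≈ λ ε 0<ε → eventually-map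
    (λ n eq → subst (ℚ._< ε) (sym (cong (λ t → ℚ.∣ t ℚ.- 1ℚ ∣) eq)) 0<ε) *-recip-tail

  -- The reciprocal of an eventual upper bound of x serves as the gap.
  0<inverse : 0ℝ < inverse x (inj₂ 0<x)
  0<inverse =
    let B , 0<B , x≤B = bounded x
        η , 0<η , Bη≡1 = divide 0<B (ℚ.positive⁻¹ 1ℚ)
    in mk< η 0<η (eventually-map (λ n ((0<xₙ , xr≡1) , xₙ≤B) →
        subst (ℚ._≤ recip (seq x n)) (sym (ℚ.+-identityˡ η))
          (ℚ.*-cancelˡ-≤-pos (seq x n) {{ℚ.positive 0<xₙ}} (subst (seq x n ℚ.* η ℚ.≤_)
            (trans Bη≡1 (sym xr≡1))
            (ℚ.*-monoʳ-≤-nonNeg η {{ℚ.nonNegative (ℚ.<⇒≤ 0<η)}} (ℚ.≤-trans (p≤∣p∣ (seq x n)) xₙ≤B)))))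
      (positive-tail ∩ *-recip-tail ∩ x≤B))

0<y∧x*y≈0⇒x≈0 : ∀ {x y} → 0ℝ < y → x * y ≈ 0ℝ → x ≈ 0ℝ
0<y∧x*y≈0⇒x≈0 {x} {y} 0<y xy≈0 = begin
  x                   ≈⟨ R.*-identityʳ x ⟨
  x * 1ℝ              ≈⟨ *-congˡ {x} (*-inverse 0<y) ⟨
  x * (y * y⁻¹)       ≈⟨ R.*-assoc x y y⁻¹ ⟨
  x * y * y⁻¹         ≈⟨ *-cong xy≈0 ≈-refl ⟩
  0ℝ * y⁻¹            ≈⟨ R.zeroˡ y⁻¹ ⟩
  0ℝ                  ∎
  where
  open ≈-Reasoning
  y⁻¹ = inverse y (inj₂ 0<y)

-- Natural numbers inside the rationals and the reals

ℕ→ℚ : ℕ → ℚ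
ℕ→ℚ n = + n ℚ./ 1

-- Division normalises through a gcd that is stuck on a variable; in the explicit form, sums and
-- comparisons reduce to those of integers.
ℕ→ℚ≡mkℚ : ∀ n → ℕ→ℚ n ≡ mkℚ (+ n) 0 (Coprime.sym (1-coprimeTo n))
ℕ→ℚ≡mkℚ n = ℚ.↥p/↧p≡p (mkℚ (+ n) 0 (Coprime.sym (1-coprimeTo n)))

ℕ→ℚ-+ : ∀ m n → ℕ→ℚ (m ℕ.+ n) ≡ ℕ→ℚ m ℚ.+ ℕ→ℚ n
ℕ→ℚ-+ m n = trans
  (cong (ℚ._/ 1) (sym (cong₂ ℤ._+_ (ℤ.*-identityʳ (+ m)) (ℤ.*-identityʳ (+ n)))))
  (sym (cong₂ ℚ._+_ (ℕ→ℚ≡mkℚ m) (ℕ→ℚ≡mkℚ n)))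

ℕ→ℚ-suc : ∀ n → ℕ→ℚ (suc n) ≡ 1ℚ ℚ.+ ℕ→ℚ n
ℕ→ℚ-suc n = ℕ→ℚ-+ 1 n

ℕ→ℚ-mono-< : ∀ {m n} → m ℕ.< n → ℕ→ℚ m ℚ.< ℕ→ℚ n
ℕ→ℚ-mono-< {m} {n} m<n = subst₂ ℚ._<_ (sym (ℕ→ℚ≡mkℚ m)) (sym (ℕ→ℚ≡mkℚ n))
  (ℚ.*<* (subst₂ ℤ._<_ (sym (ℤ.*-identityʳ (+ m))) (sym (ℤ.*-identityʳ (+ n))) (ℤ.+<+ m<n)))

ℕ→ℚ-mono-≤ : ∀ {m n} → m ℕ.≤ n → ℕ→ℚ m ℚ.≤ ℕ→ℚ n
ℕ→ℚ-mono-≤ {m} {n} m≤n = subst₂ ℚ._≤_ (sym (ℕ→ℚ≡mkℚ m)) (sym (ℕ→ℚ≡mkℚ n))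
  (ℚ.*≤* (subst₂ ℤ._≤_ (sym (ℤ.*-identityʳ (+ m))) (sym (ℤ.*-identityʳ (+ n))) (ℤ.+≤+ m≤n)))

fromℕ-mono-< : ∀ {m n} → m ℕ.< n → fromℕ m < fromℕ n
fromℕ-mono-< m<n = fromℚ-mono-< (ℕ→ℚ-mono-< m<n)

fromℕ-injective : ∀ {m n} → fromℕ m ≈ fromℕ n → m ≡ n
fromℕ-injective {m} {n} p with ℕ.<-cmp m n
... | tri< m<n _ _ = contradiction (fromℕ-mono-< m<n) (<-irrefl p)
... | tri≈ _ m≡n _ = m≡n
... | tri> _ _ n<m = contradiction (fromℕ-mono-< n<m) (<-irrefl (≈-sym p))

-- Bisection and Chebyshev polynomials

2ℚ : ℚ
2ℚ = 1ℚ ℚ.+ 1ℚ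

2ℝ : ℝ
2ℝ = fromℚ 2ℚ

-- A positive fraction is at least the reciprocal of its denominator `suc d`, so d is a witness.
archimedean : ∀ {ε} → 0ℚ ℚ.< ε → ∃[ n ] 1ℚ ℚ.≤ ε ℚ.* ℕ→ℚ (suc n)
archimedean {mkℚ (+ zero) d _} 0<ε with () ← ℚ.positive 0<ε
archimedean {mkℚ -[1+ _ ] d _} 0<ε with () ← ℚ.positive 0<ε
archimedean {ε@(mkℚ +[1+ p ] d _)} 0<ε = d ,
  subst (λ t → 1ℚ ℚ.≤ ε ℚ.* t) (sym (ℕ→ℚ≡mkℚ (suc d)))
    (subst (ℚ._≤ ε ℚ.* D) (ℚ.*-inverseˡ D) (ℚ.*-monoʳ-≤-nonNeg D {ℚ.1/ D} {ε} 1/D≤ε))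
  where
  D : ℚ
  D = mkℚ (+ suc d) 0 (Coprime.sym (1-coprimeTo (suc d)))
  1/D≤ε : ℚ.1/ D ℚ.≤ ε
  1/D≤ε = ℚ.*≤* (ℤ.*-monoʳ-≤-nonNeg (+ suc d) {+ 1} {+[1+ p ]} (ℤ.+≤+ (ℕ.s≤s ℕ.z≤n)))

-- Both sign conditions are weak, so a midpoint can always replace one of the ends by totality of
-- the order on rationals, even where q vanishes.
record Bracket (q : ℚ → ℚ) : Set where
  field
    lo hi : ℚ
    lo≤hi : lo ℚ.≤ hi
    q[lo]≤0 : q lo ℚ.≤ 0ℚ
    0≤q[hi] : 0ℚ ℚ.≤ q hi

  width : ℚ
  width = hi ℚ.- lo

open Bracket

Refines : ∀ {q} → Bracket q → Bracket q → Set
Refines B B′ = lo B ℚ.≤ lo B′ × hi B′ ℚ.≤ hi B × width B′ ≡ ½ ℚ.* width B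

halve : ∀ {q} (B : Bracket q) → Σ[ B′ ∈ Bracket q ] Refines B B′
halve {q} B = choose (ℚ.≤-total (q mid) 0ℚ)
  where
  w = width B
  mid = lo B ℚ.+ ½ ℚ.* w
  0≤½w : 0ℚ ℚ.≤ ½ ℚ.* w
  0≤½w = 0≤p*q (ℚ.<⇒≤ (ℚ.positive⁻¹ ½)) (p≤q⇒0≤q-p (lo≤hi B))
  mid+½w : mid ℚ.+ ½ ℚ.* w ≡ hi B
  mid+½w = trans (½+½ (lo B) w) (solve 2 (λ l h → l :+ (h :- l) := h) refl (lo B) (hi B))
  lo≤mid : lo B ℚ.≤ mid
  lo≤mid = p≤p+q (lo B) 0≤½w
  mid≤hi : mid ℚ.≤ hi B
  mid≤hi = subst (mid ℚ.≤_) mid+½w (p≤p+q mid 0≤½w)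
  cancel : ∀ a b → (a ℚ.+ b) ℚ.- a ≡ b
  cancel = solve 2 (λ a b → (a :+ b) :- a := b) refl
  choose : q mid ℚ.≤ 0ℚ ⊎ 0ℚ ℚ.≤ q mid → Σ[ B′ ∈ Bracket q ] Refines B B′
  choose (inj₁ ≤0) = record { lo = mid ; hi = hi B ; lo≤hi = mid≤hi ; q[lo]≤0 = ≤0 ; 0≤q[hi] = 0≤q[hi] B } ,
    lo≤mid , ℚ.≤-refl , trans (cong (ℚ._- mid) (sym mid+½w)) (cancel mid (½ ℚ.* w))
  choose (inj₂ 0≤) = record { lo = lo B ; hi = mid ; lo≤hi = lo≤mid ; q[lo]≤0 = q[lo]≤0 B ; 0≤q[hi] = 0≤ } ,
    ℚ.≤-refl , mid≤hi , cancel (lo B) (½ ℚ.* w)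

module Bisection {q : ℚ → ℚ} (B₀ : Bracket q) (w₀≤1 : width B₀ ℚ.≤ 1ℚ) where

  bracket : ℕ → Bracket q
  bracket zero    = B₀
  bracket (suc n) = proj₁ (halve (bracket n))

  refines : ∀ n → Refines (bracket n) (bracket (suc n))
  refines n = proj₂ (halve (bracket n))

  bracket-nested : ∀ {m n} → m ℕ.≤′ n → lo (bracket m) ℚ.≤ lo (bracket n) × hi (bracket n) ℚ.≤ hi (bracket m)
  bracket-nested (ℕ.≤′-reflexive refl) = ℚ.≤-refl , ℚ.≤-refl
  bracket-nested (ℕ.≤′-step {n} m≤n) =
    let lo≤ , ≤hi = bracket-nested m≤n
        lo≤′ , ≤hi′ , _ = refines n
    in ℚ.≤-trans lo≤ lo≤′ , ℚ.≤-trans ≤hi′ ≤hi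

  0≤width : ∀ n → 0ℚ ℚ.≤ width (bracket n)
  0≤width n = p≤q⇒0≤q-p (lo≤hi (bracket n))

  -- A linear rate instead of the true exponential one: it is enough for convergence and pairs
  -- directly with `archimedean`.
  width*suc≤1 : ∀ n → width (bracket n) ℚ.* ℕ→ℚ (suc n) ℚ.≤ 1ℚ
  width*suc≤1 zero    = subst (ℚ._≤ 1ℚ) (sym (ℚ.*-identityʳ (width B₀))) w₀≤1
  width*suc≤1 (suc n) = ℚ.≤-trans (ℚ.≤-trans
    (ℚ.≤-reflexive (cong₂ ℚ._*_ (proj₂ (proj₂ (refines n))) (ℕ→ℚ-suc (suc n))))
    (subst (½ ℚ.* w ℚ.* (1ℚ ℚ.+ m) ℚ.≤_)
      -- With h half the width and m ≥ 1, h (1 + m) is at most 2 h m, which the induction hypothesis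
      -- bounds.
      (solve 2 (λ h m → h :* (con 1ℚ :+ m) :+ h :* (m :- con 1ℚ) := (h :+ h) :* m) refl (½ ℚ.* w) m)
      (p≤p+q (½ ℚ.* w ℚ.* (1ℚ ℚ.+ m))
        (0≤p*q (0≤p*q (ℚ.<⇒≤ (ℚ.positive⁻¹ ½)) (0≤width n))
               (p≤q⇒0≤q-p {1ℚ} {m} (ℕ→ℚ-mono-≤ {1} {suc n} (ℕ.s≤s ℕ.z≤n)))))))
    (subst (λ t → t ℚ.* m ℚ.≤ 1ℚ)
      (trans (sym (ℚ.+-identityˡ w)) (trans (sym (½+½ 0ℚ w)) (cong (ℚ._+ ½ ℚ.* w) (ℚ.+-identityˡ (½ ℚ.* w)))))
      (width*suc≤1 n))
    where
    w = width (bracket n)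
    m = ℕ→ℚ (suc n)

  width-small : ∀ {ε} → 0ℚ ℚ.< ε → ∃[ N ] width (bracket N) ℚ.< ε
  width-small {ε} 0<ε = suc n , ℚ.*-cancelʳ-<-nonNeg (ℕ→ℚ (suc (suc n)))
      {{ℚ.nonNegative (ℕ→ℚ-mono-≤ {0} {suc (suc n)} ℕ.z≤n)}}
      (ℚ.≤-<-trans (width*suc≤1 (suc n)) (ℚ.≤-<-trans 1≤ε*suc
        (ℚ.*-monoʳ-<-pos ε {{ℚ.positive 0<ε}} (ℕ→ℚ-mono-< {suc n} {suc (suc n)} (ℕ.n<1+n (suc n))))))
    where
    n = proj₁ (archimedean 0<ε)
    1≤ε*suc = proj₂ (archimedean 0<ε)

  within : ∀ {f : ℕ → ℚ} → (∀ n → lo (bracket n) ℚ.≤ f n × f n ℚ.≤ hi (bracket n)) →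
           ∀ {N n} → N ℕ.≤ n → lo (bracket N) ℚ.≤ f n × f n ℚ.≤ hi (bracket N)
  within inside {N} {n} N≤n =
    let lo≤ , ≤hi = bracket-nested (ℕ.≤⇒≤′ N≤n)
        lo≤f , f≤hi = inside n
    in ℚ.≤-trans lo≤ lo≤f , ℚ.≤-trans f≤hi ≤hi

  apart<ε : ∀ {a b N ε} → width (bracket N) ℚ.< ε → lo (bracket N) ℚ.≤ b → a ℚ.≤ hi (bracket N) → a ℚ.< b ℚ.+ ε
  apart<ε {a} {b} {N} {ε} w<ε lo≤b a≤hi = ℚ.≤-<-trans a≤hi (subst (ℚ._< b ℚ.+ ε)
    (solve 2 (λ l h → l :+ (h :- l) := h) refl (lo (bracket N)) (hi (bracket N)))
    (ℚ.+-mono-≤-< lo≤b w<ε))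

  abstract
    squeezed-cauchy : ∀ {f : ℕ → ℚ} → (∀ n → lo (bracket n) ℚ.≤ f n × f n ℚ.≤ hi (bracket n)) → IsCauchy f
    squeezed-cauchy inside ε 0<ε =
      let N , w<ε = width-small 0<ε
      in N , λ m n ≤m ≤n → ∣p-q∣<ε
        (apart<ε {N = N} w<ε (proj₁ (within inside ≤n)) (proj₂ (within inside ≤m)))
        (apart<ε {N = N} w<ε (proj₁ (within inside ≤m)) (proj₂ (within inside ≤n)))

  inside-lo : ∀ n → lo (bracket n) ℚ.≤ lo (bracket n) × lo (bracket n) ℚ.≤ hi (bracket n)
  inside-lo n = ℚ.≤-refl , lo≤hi (bracket n)

  inside-hi : ∀ n → lo (bracket n) ℚ.≤ hi (bracket n) × hi (bracket n) ℚ.≤ hi (bracket n)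
  inside-hi n = lo≤hi (bracket n) , ℚ.≤-refl

  root root⁺ : ℝ
  root  = mkℝ (λ n → lo (bracket n)) (squeezed-cauchy inside-lo)
  root⁺ = mkℝ (λ n → hi (bracket n)) (squeezed-cauchy inside-hi)

  root≈root⁺ : root ≈ root⁺
  root≈root⁺ = mk≈ λ ε 0<ε →
    let N , w<ε = width-small 0<ε
    in N , λ n ≤n → ∣p-q∣<ε
        (apart<ε {N = N} w<ε (proj₁ (within inside-hi ≤n)) (proj₂ (within inside-lo ≤n)))
        (apart<ε {N = N} w<ε (proj₁ (within inside-lo ≤n)) (proj₂ (within inside-hi ≤n)))

  lo₀≤root : ∀ n → lo B₀ ℚ.≤ seq root n
  lo₀≤root n = proj₁ (within inside-lo {0} {n} ℕ.z≤n)

  root≤hi₀ : ∀ n → seq root n ℚ.≤ hi B₀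
  root≤hi₀ n = proj₂ (within inside-lo {0} {n} ℕ.z≤n)

  -- The same real is represented by the lower ends, along which p is at most 0, and by the upper
  -- ends, along which p is at least 0. Continuity of p enters only as congruence: the two value
  -- sequences approach each other and hence 0.
  vanishes-at-root : (p : ℝ → ℝ) → (∀ {x y} → x ≈ y → p x ≈ p y) →
                     (∀ x n → seq (p x) n ≡ q (seq x n)) → p root ≈ 0ℝ
  vanishes-at-root p p-cong p≡q = mk≈ λ ε 0<ε → eventually-map
    (λ n hi<lo+ε → ∣p-q∣<ε
      (ℚ.≤-<-trans (subst (ℚ._≤ 0ℚ) (sym (p≡q root n)) (q[lo]≤0 (bracket n)))
        (subst (0ℚ ℚ.<_) (sym (ℚ.+-identityˡ ε)) 0<ε))
      (ℚ.≤-<-trans (subst (0ℚ ℚ.≤_) (sym (p≡q root⁺ n)) (0≤q[hi] (bracket n))) hi<lo+ε))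
    (≈⇒≤+ (p-cong (≈-sym root≈root⁺)) 0<ε)

-- U t n = sin (n φ) / sin φ for t = 2 cos φ.
Uℚ : ℚ → ℕ → ℚ
Uℚ t zero          = 0ℚ
Uℚ t (suc zero)    = 1ℚ
Uℚ t (suc (suc n)) = t ℚ.* Uℚ t (suc n) ℚ.- Uℚ t n

U : ℝ → ℕ → ℝ
U t zero          = 0ℝ
U t (suc zero)    = 1ℝ
U t (suc (suc n)) = t * U t (suc n) - U t n

seq-U : ∀ t n k → seq (U t n) k ≡ Uℚ (seq t k) n
seq-U t zero          k = refl
seq-U t (suc zero)    k = refl
seq-U t (suc (suc n)) k = cong₂ (λ a b → seq t k ℚ.* a ℚ.- b) (seq-U t (suc n) k) (seq-U t n k)

U-cong : ∀ {s t} n → s ≈ t → U s n ≈ U t n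
U-cong zero          s≈t = ≈-refl
U-cong (suc zero)    s≈t = ≈-refl
U-cong (suc (suc n)) s≈t = +-cong (*-cong s≈t (U-cong (suc n) s≈t)) (neg-cong (U-cong n s≈t))

Uℚ-2 : ∀ n → Uℚ 2ℚ n ≡ ℕ→ℚ n
Uℚ-2 zero          = refl
Uℚ-2 (suc zero)    = refl
Uℚ-2 (suc (suc n)) = begin
  2ℚ ℚ.* Uℚ 2ℚ (suc n) ℚ.- Uℚ 2ℚ n
    ≡⟨ cong₂ (λ a b → 2ℚ ℚ.* a ℚ.- b) (trans (Uℚ-2 (suc n)) (ℕ→ℚ-suc n)) (Uℚ-2 n) ⟩
  2ℚ ℚ.* (1ℚ ℚ.+ ℕ→ℚ n) ℚ.- ℕ→ℚ n
    ≡⟨ solve 1 (λ q → (con 1ℚ :+ con 1ℚ) :* (con 1ℚ :+ q) :- q := con 1ℚ :+ (con 1ℚ :+ q)) refl (ℕ→ℚ n) ⟩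
  1ℚ ℚ.+ (1ℚ ℚ.+ ℕ→ℚ n)      ≡⟨ cong (1ℚ ℚ.+_) (ℕ→ℚ-suc n) ⟨
  1ℚ ℚ.+ ℕ→ℚ (suc n)         ≡⟨ ℕ→ℚ-suc (suc n) ⟨
  ℕ→ℚ (suc (suc n))          ∎
  where open ≡-Reasoning

double : ℕ → ℕ
double zero    = zero
double (suc n) = suc (suc (double n))

n≤double : ∀ n → n ℕ.≤ double n
n≤double zero    = ℕ.z≤n
n≤double (suc n) = ℕ.s≤s (ℕ.m≤n⇒m≤1+n (n≤double n))

halves : ∀ n → ∃[ h ] (n ≡ double h ⊎ n ≡ suc (double h))
halves zero = 0 , inj₁ refl
halves (suc n) with halves n
... | h , inj₁ eq = h , inj₂ (cong suc eq)
... | h , inj₂ eq = suc h , inj₁ (cong suc eq)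

module _ (t : ℚ) where

  private
    s = t ℚ.* t ℚ.- 2ℚ

  -- Here s = 2 cos 2φ, so `Uℚ s h` is sin 2hφ / sin 2φ. The factor t is sin 2φ / sin φ, and the odd
  -- case is sin 2hφ + sin (2h + 2)φ = 2 sin (2h + 1)φ cos φ.
  Uℚ-half-angle : ∀ h → Uℚ t (double h) ≡ t ℚ.* Uℚ s h ×
                        Uℚ t (suc (double h)) ≡ Uℚ s h ℚ.+ Uℚ s (suc h)
  Uℚ-half-angle zero    = sym (ℚ.*-zeroʳ t) , sym (ℚ.+-identityˡ 1ℚ)
  Uℚ-half-angle (suc h) with Uℚ-half-angle h
  ... | even , odd = even′ , trans (cong₂ (λ a b → t ℚ.* a ℚ.- b) even′ odd)
    (solve 3 (λ t a b → t :* (t :* b) :- (a :+ b) :=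
      b :+ ((t :* t :- (con 1ℚ :+ con 1ℚ)) :* b :- a)) refl t (Uℚ s h) (Uℚ s (suc h)))
    where
    even′ = trans (cong₂ (λ a b → t ℚ.* a ℚ.- b) odd even)
      (solve 3 (λ t a b → t :* (a :+ b) :- t :* a := t :* b) refl t (Uℚ s h) (Uℚ s (suc h)))

  -- These are sin 2hφ = 2 sin hφ cos hφ and sin (2h + 1)φ sin φ = sin² (h + 1)φ - sin² hφ. The
  -- second factor of the even case is 2 cos hφ, the difference of the values at h + 1 and h - 1,
  -- where the latter is expressed by the recurrence so that h = 0 is covered.
  Uℚ-double : ∀ h → Uℚ t (double h) ≡ Uℚ t h ℚ.* (Uℚ t (suc h) ℚ.+ (Uℚ t (suc h) ℚ.- t ℚ.* Uℚ t h)) ×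
                    Uℚ t (suc (double h)) ≡ Uℚ t (suc h) ℚ.* Uℚ t (suc h) ℚ.- Uℚ t h ℚ.* Uℚ t h
  Uℚ-double zero    = solve 1 (λ t → con 0ℚ := con 0ℚ :* (con 1ℚ :+ (con 1ℚ :- t :* con 0ℚ))) refl t , refl
  Uℚ-double (suc h) with Uℚ-double h
  ... | even , odd = even′ , trans (cong₂ (λ x y → t ℚ.* x ℚ.- y) even′ odd)
    (solve 3 (λ t a b → t :* (b :* ((t :* b :- a) :+ ((t :* b :- a) :- t :* b))) :- (b :* b :- a :* a) :=
      (t :* b :- a) :* (t :* b :- a) :- b :* b) refl t (Uℚ t h) (Uℚ t (suc h)))
    where
    even′ = trans (cong₂ (λ x y → t ℚ.* x ℚ.- y) odd even)
      (solve 3 (λ t a b → t :* (b :* b :- a :* a) :- a :* (b :+ (b :- t :* a)) :=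
        b :* ((t :* b :- a) :+ ((t :* b :- a) :- t :* b))) refl t (Uℚ t h) (Uℚ t (suc h)))

  -- Cassini's identity: the left side is the square of the value at h + 1 minus the product of its
  -- two neighbours, and the recurrence preserves it.
  Uℚ-invariant : ∀ h →
    Uℚ t (suc h) ℚ.* Uℚ t (suc h) ℚ.+ Uℚ t h ℚ.* Uℚ t h ℚ.- t ℚ.* Uℚ t h ℚ.* Uℚ t (suc h) ≡ 1ℚ
  Uℚ-invariant zero    = solve 1 (λ t →
    con 1ℚ :* con 1ℚ :+ con 0ℚ :* con 0ℚ :- t :* con 0ℚ :* con 1ℚ := con 1ℚ) refl t
  Uℚ-invariant (suc h) = trans
    (solve 3 (λ t a b → (t :* b :- a) :* (t :* b :- a) :+ b :* b :- t :* b :* (t :* b :- a) :=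
      b :* b :+ a :* a :- t :* a :* b) refl t (Uℚ t h) (Uℚ t (suc h)))
    (Uℚ-invariant h)

-- t₀ = 8/5 only has to exceed 1, and to make U t₀ 5, …, U t₀ 9 negative.
t₀ : ℚ
t₀ = + 8 ℚ./ 5

-- Two consecutive indices at the same point s are needed, because the value at an odd index 2h + 1
-- is governed by the sum of the values at h and h + 1, both in doubling and in the bracket for an
-- odd cycle.
NegativeAt : ℕ → Set
NegativeAt h = ∃[ s ] t₀ ℚ.≤ s × s ℚ.≤ 2ℚ × Uℚ s h ℚ.< 0ℚ × Uℚ s (suc h) ℚ.< 0ℚ

2-s≤1 : ∀ {s} → t₀ ℚ.≤ s → 2ℚ ℚ.- s ℚ.≤ 1ℚ
2-s≤1 {s} t₀≤s = ℚ.≤-trans (ℚ.+-monoʳ-≤ 2ℚ (ℚ.neg-antimono-≤ t₀≤s)) (from-yes (2ℚ ℚ.- t₀ ℚ.≤? 1ℚ))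

-- Doubling an index from 5 on gives 10 or more, so 5 to 9 have to be checked by computation.
negativeAt-base : ∀ h → h ℕ.< 5 → NegativeAt (5 ℕ.+ h)
negativeAt-base 0 _ = t₀ , ℚ.≤-refl , from-yes (t₀ ℚ.≤? 2ℚ) ,
  from-yes (Uℚ t₀ 5 ℚ.<? 0ℚ) , from-yes (Uℚ t₀ 6 ℚ.<? 0ℚ)
negativeAt-base 1 _ = t₀ , ℚ.≤-refl , from-yes (t₀ ℚ.≤? 2ℚ) ,
  from-yes (Uℚ t₀ 6 ℚ.<? 0ℚ) , from-yes (Uℚ t₀ 7 ℚ.<? 0ℚ)
negativeAt-base 2 _ = t₀ , ℚ.≤-refl , from-yes (t₀ ℚ.≤? 2ℚ) ,
  from-yes (Uℚ t₀ 7 ℚ.<? 0ℚ) , from-yes (Uℚ t₀ 8 ℚ.<? 0ℚ)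
negativeAt-base 3 _ = t₀ , ℚ.≤-refl , from-yes (t₀ ℚ.≤? 2ℚ) ,
  from-yes (Uℚ t₀ 8 ℚ.<? 0ℚ) , from-yes (Uℚ t₀ 9 ℚ.<? 0ℚ)
-- At `t₀` the angle 10φ already exceeds 2π and the value at 10 is positive; the point 9/5 has a
-- smaller angle.
negativeAt-base 4 _ = s , from-yes (t₀ ℚ.≤? s) , from-yes (s ℚ.≤? 2ℚ) ,
  from-yes (Uℚ s 9 ℚ.<? 0ℚ) , from-yes (Uℚ s 10 ℚ.<? 0ℚ)
  where
  s = + 9 ℚ./ 5
negativeAt-base (suc (suc (suc (suc (suc _))))) (ℕ.s≤s (ℕ.s≤s (ℕ.s≤s (ℕ.s≤s (ℕ.s≤s ())))))

x<0⇒eventually<0 : ∀ {x} → x < 0ℝ → Eventually (λ n → seq x n ℚ.< 0ℚ)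
x<0⇒eventually<0 {x} (mk< g 0<g sep) = eventually-map (λ n x+g≤0 → ℚ.<-≤-trans
  (subst (ℚ._< seq x n ℚ.+ g) (ℚ.+-identityʳ (seq x n)) (ℚ.+-monoʳ-< (seq x n) 0<g)) x+g≤0) sep

-- With t = 2 cos φ and s = t² - 2 = 2 cos 2φ, the signs of U s at h and h + 1
-- decide those of U t at 2h, 2h + 1 and 2h + 2.
negativeAt-double : ∀ h → NegativeAt h → NegativeAt (double h) × NegativeAt (suc (double h))
negativeAt-double h (s , t₀≤s , s≤2 , Uh<0 , Usuch<0) =
  (tₖ , t₀≤t , t≤2 , even<0 , odd<0) , (tₖ , t₀≤t , t≤2 , odd<0 , even′<0)
  where
  q : ℚ → ℚ
  -- The root is the square root of s + 2, that is, 2 cos of half the angle of s. The bracket from s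
  -- to 2 contains it since q(s) = -(2 - s)(s + 1), and it keeps the new point above `t₀`.
  q t = (t ℚ.* t ℚ.- 2ℚ) ℚ.- s
  0≤2-s : 0ℚ ℚ.≤ 2ℚ ℚ.- s
  0≤2-s = p≤q⇒0≤q-p s≤2
  0≤s+1 : 0ℚ ℚ.≤ s ℚ.+ 1ℚ
  0≤s+1 = 0≤p+q (ℚ.≤-trans (from-yes (0ℚ ℚ.≤? t₀)) t₀≤s) (from-yes (0ℚ ℚ.≤? 1ℚ))
  q[s]≤0 : q s ℚ.≤ 0ℚ
  q[s]≤0 = subst (ℚ._≤ 0ℚ)
    (solve 1 (λ s → :- (((con 1ℚ :+ con 1ℚ) :- s) :* (s :+ con 1ℚ)) :=
      (s :* s :- (con 1ℚ :+ con 1ℚ)) :- s) refl s)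
    (ℚ.neg-antimono-≤ (0≤p*q 0≤2-s 0≤s+1))
  0≤q[2] : 0ℚ ℚ.≤ q 2ℚ
  0≤q[2] = 0≤2-s
  B₀ : Bracket q
  B₀ = record { lo = s ; hi = 2ℚ ; lo≤hi = s≤2 ; q[lo]≤0 = q[s]≤0 ; 0≤q[hi] = 0≤q[2] }
  open Bisection B₀ (2-s≤1 t₀≤s)
  t = root
  t²-2≈s : t * t - 2ℝ ≈ fromℚ s
  t²-2≈s = begin
    t * t - 2ℝ
      ≈⟨ pointwise (λ k → solve 2 (λ a s → a := (a :- s) :+ s) refl (seq (t * t - 2ℝ) k) s) ⟩
    (t * t - 2ℝ) - fromℚ s + fromℚ s
      ≈⟨ +-cong (vanishes-at-root (λ x → (x * x - 2ℝ) - fromℚ s)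
           (λ x≈y → +-cong (+-cong (*-cong x≈y x≈y) ≈-refl) ≈-refl) (λ _ _ → refl)) ≈-refl ⟩
    0ℝ + fromℚ s                            ≈⟨ R.+-identityˡ (fromℚ s) ⟩
    fromℚ s                                 ∎
    where open ≈-Reasoning
  negative-tail : ∀ n → Uℚ s n ℚ.< 0ℚ → Eventually (λ k → Uℚ (seq t k ℚ.* seq t k ℚ.- 2ℚ) n ℚ.< 0ℚ)
  negative-tail n U<0 = eventually-map
    (λ k → subst (ℚ._< 0ℚ) (seq-U (t * t - 2ℝ) n k))
    (x<0⇒eventually<0 (<-resp-≈ {fromℚ (Uℚ s n)} {U (t * t - 2ℝ) n} {0ℝ} {0ℝ}
      (≈-trans (pointwise λ k → sym (seq-U (fromℚ s) n k)) (U-cong n (≈-sym t²-2≈s))) ≈-refl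
      (fromℚ-mono-< U<0)))
  -- The root t is real while a rational point is required. Both inequalities are strict, so they
  -- persist at a late enough approximation of t.
  witness = eventually-common (negative-tail h Uh<0 ∩ negative-tail (suc h) Usuch<0)
  tₖ = seq t (proj₁ witness)
  sₖ = tₖ ℚ.* tₖ ℚ.- 2ℚ
  t₀≤t : t₀ ℚ.≤ tₖ
  t₀≤t = ℚ.≤-trans t₀≤s (lo₀≤root (proj₁ witness))
  t≤2 : tₖ ℚ.≤ 2ℚ
  t≤2 = root≤hi₀ (proj₁ witness)
  t*neg<0 : ∀ {p} → p ℚ.< 0ℚ → tₖ ℚ.* p ℚ.< 0ℚ
  t*neg<0 {p} p<0 = subst (tₖ ℚ.* p ℚ.<_) (ℚ.*-zeroʳ tₖ)
    (ℚ.*-monoʳ-<-pos tₖ {{ℚ.positive (ℚ.<-≤-trans (from-yes (0ℚ ℚ.<? t₀)) t₀≤t)}} p<0)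
  sum<0 : Uℚ sₖ h ℚ.+ Uℚ sₖ (suc h) ℚ.< 0ℚ
  sum<0 = ℚ.+-mono-< (proj₁ (proj₂ witness)) (proj₂ (proj₂ witness))
  even<0 : Uℚ tₖ (double h) ℚ.< 0ℚ
  even<0 = subst (ℚ._< 0ℚ) (sym (proj₁ (Uℚ-half-angle tₖ h))) (t*neg<0 (proj₁ (proj₂ witness)))
  odd<0 : Uℚ tₖ (suc (double h)) ℚ.< 0ℚ
  odd<0 = subst (ℚ._< 0ℚ) (sym (proj₂ (Uℚ-half-angle tₖ h))) sum<0
  even′<0 : Uℚ tₖ (double (suc h)) ℚ.< 0ℚ
  even′<0 = subst (ℚ._< 0ℚ) (sym (proj₁ (Uℚ-half-angle tₖ (suc h)))) (t*neg<0 (proj₂ (proj₂ witness)))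

-- An index 10 + i is twice 5 + h or one more, where h is half of i rounded down, and 5 + h is
-- smaller.
negativeAt : ∀ i → NegativeAt (5 ℕ.+ i)
negativeAt = <-rec (λ i → NegativeAt (5 ℕ.+ i)) step
  where
  step : ∀ i → (∀ {j} → j ℕ.< i → NegativeAt (5 ℕ.+ j)) → NegativeAt (5 ℕ.+ i)
  step (suc (suc (suc (suc (suc i))))) ih with halves i
  ... | h , inj₁ refl = proj₁ (negativeAt-double (5 ℕ.+ h)
    (ih (ℕ.s≤s (ℕ.≤-trans (n≤double h) (ℕ.m≤n+m (double h) 4)))))
  ... | h , inj₂ refl = proj₂ (negativeAt-double (5 ℕ.+ h)
    (ih (ℕ.s≤s (ℕ.≤-trans (n≤double h) (ℕ.m≤n+m (double h) 5)))))
  step 0 _ = negativeAt-base 0 (from-yes (0 ℕ.<? 5))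
  step 1 _ = negativeAt-base 1 (from-yes (1 ℕ.<? 5))
  step 2 _ = negativeAt-base 2 (from-yes (2 ℕ.<? 5))
  step 3 _ = negativeAt-base 3 (from-yes (3 ℕ.<? 5))
  step 4 _ = negativeAt-base 4 (from-yes (4 ℕ.<? 5))

-- t = 2 cos (2πj/n) for some j ≥ 1: the values U t 1, U t 2, … have period n.
record CyclicRoot (n : ℕ) : Set where
  field
    t        : ℝ
    t₀≤t      : ∀ k → t₀ ℚ.≤ seq t k
    U[n]≈0   : U t n ≈ 0ℝ
    U[1+n]≈1 : U t (suc n) ≈ 1ℝ

factor-vanishes : ∀ {x y z} → (∀ k → seq x k ≡ seq y k ℚ.* seq z k) → y ≈ 0ℝ → x ≈ 0ℝ
factor-vanishes {x} {y} {z} x≡yz y≈0 =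
  ≈-trans (pointwise {x} {y * z} x≡yz) (≈-trans (*-cong y≈0 ≈-refl) (R.zeroˡ z))

factor-vanishes-1 : ∀ {x y z} → (∀ k → seq x k ≡ 1ℚ ℚ.+ seq y k ℚ.* seq z k) → y ≈ 0ℝ → x ≈ 1ℝ
factor-vanishes-1 {x} {y} {z} x≡ y≈0 = ≈-trans (pointwise {x} {1ℝ + y * z} x≡)
  (≈-trans (+-cong ≈-refl (factor-vanishes {y * z} {y} {z} (λ _ → refl) y≈0)) (R.+-identityʳ 1ℝ))

-- A zero of U at h means sin hφ = 0, so that 2hφ is a multiple of 2π. The bracket exists because
-- the value at s is negative and the value at 2 is h. At 2h + 1, the invariant isolates the 1 from
-- a multiple of `U t h`.
cyclicRoot-even : ∀ h → NegativeAt h → CyclicRoot (double h)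
cyclicRoot-even h (s , t₀≤s , s≤2 , Uh<0 , _) = record
  { t = t
  ; t₀≤t = λ k → ℚ.≤-trans t₀≤s (lo₀≤root k)
  ; U[n]≈0 = factor-vanishes {z = U t (suc h) + (U t (suc h) - t * U t h)}
      (λ k → trans (seq-U t (double h) k) (trans (proj₁ (Uℚ-double (seq t k) h))
        (sym (cong₂ (λ a b → a ℚ.* (b ℚ.+ (b ℚ.- seq t k ℚ.* a))) (seq-U t h k) (seq-U t (suc h) k)))))
      U[h]≈0
  ; U[1+n]≈1 = factor-vanishes-1 {z = t * U t (suc h) - U t h - U t h}
      (λ k → trans (seq-U t (suc (double h)) k) (trans (odd (seq t k))
        (sym (cong₂ (λ a b → 1ℚ ℚ.+ a ℚ.* (seq t k ℚ.* b ℚ.- a ℚ.- a)) (seq-U t h k) (seq-U t (suc h) k)))))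
      U[h]≈0
  }
  where
  B₀ : Bracket (λ t → Uℚ t h)
  B₀ = record
    { lo = s ; hi = 2ℚ ; lo≤hi = s≤2
    ; q[lo]≤0 = ℚ.<⇒≤ Uh<0
    ; 0≤q[hi] = subst (0ℚ ℚ.≤_) (sym (Uℚ-2 h)) (ℕ→ℚ-mono-≤ {0} {h} ℕ.z≤n)
    }
  open Bisection B₀ (2-s≤1 t₀≤s)
  t = root
  U[h]≈0 : U t h ≈ 0ℝ
  U[h]≈0 = vanishes-at-root (λ x → U x h) (U-cong h) (λ x → seq-U x h)
  odd : ∀ t → Uℚ t (suc (double h)) ≡ 1ℚ ℚ.+ Uℚ t h ℚ.* (t ℚ.* Uℚ t (suc h) ℚ.- Uℚ t h ℚ.- Uℚ t h)
  odd t = trans (proj₂ (Uℚ-double t h)) (trans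
    (solve 3 (λ t a b → b :* b :- a :* a :=
      (b :* b :+ a :* a :- t :* a :* b) :+ a :* (t :* b :- a :- a)) refl t (Uℚ t h) (Uℚ t (suc h)))
    (cong (ℚ._+ Uℚ t h ℚ.* (t ℚ.* Uℚ t (suc h) ℚ.- Uℚ t h ℚ.- Uℚ t h)) (Uℚ-invariant t h)))

-- The sum of the values at h and h + 1 is proportional to sin ((2h + 1)φ/2), so its zero makes (2h
-- + 1)φ a multiple of 2π. It is also a factor of the value at 2h + 1 and of the value at 2h + 2
-- minus 1.
cyclicRoot-odd : ∀ h → NegativeAt h → CyclicRoot (suc (double h))
cyclicRoot-odd h (s , t₀≤s , s≤2 , Uh<0 , Usuch<0) = record
  { t = t
  ; t₀≤t = λ k → ℚ.≤-trans t₀≤s (lo₀≤root k)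
  ; U[n]≈0 = factor-vanishes {z = U t (suc h) - U t h}
      (λ k → trans (seq-U t (suc (double h)) k) (trans (odd (seq t k))
        (sym (cong₂ (λ a b → (a ℚ.+ b) ℚ.* (b ℚ.- a)) (seq-U t h k) (seq-U t (suc h) k)))))
      U[h]+U[1+h]≈0
  ; U[1+n]≈1 = factor-vanishes-1 {z = t * U t (suc h) - U t h - U t (suc h)}
      (λ k → trans (seq-U t (double (suc h)) k) (trans (even (seq t k))
        (sym (cong₂ (λ a b → 1ℚ ℚ.+ (a ℚ.+ b) ℚ.* (seq t k ℚ.* b ℚ.- a ℚ.- b)) (seq-U t h k) (seq-U t (suc h) k)))))
      U[h]+U[1+h]≈0
  }
  where
  0≤Uℚ-2 : ∀ n → 0ℚ ℚ.≤ Uℚ 2ℚ n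
  0≤Uℚ-2 n = subst (0ℚ ℚ.≤_) (sym (Uℚ-2 n)) (ℕ→ℚ-mono-≤ {0} {n} ℕ.z≤n)
  B₀ : Bracket (λ t → Uℚ t h ℚ.+ Uℚ t (suc h))
  B₀ = record
    { lo = s ; hi = 2ℚ ; lo≤hi = s≤2
    ; q[lo]≤0 = ℚ.<⇒≤ (ℚ.+-mono-< Uh<0 Usuch<0)
    ; 0≤q[hi] = 0≤p+q (0≤Uℚ-2 h) (0≤Uℚ-2 (suc h))
    }
  open Bisection B₀ (2-s≤1 t₀≤s)
  t = root
  U[h]+U[1+h]≈0 : U t h + U t (suc h) ≈ 0ℝ
  U[h]+U[1+h]≈0 = vanishes-at-root (λ x → U x h + U x (suc h))
    (λ x≈y → +-cong (U-cong h x≈y) (U-cong (suc h) x≈y))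
    (λ x k → cong₂ ℚ._+_ (seq-U x h k) (seq-U x (suc h) k))
  odd : ∀ t → Uℚ t (suc (double h)) ≡ (Uℚ t h ℚ.+ Uℚ t (suc h)) ℚ.* (Uℚ t (suc h) ℚ.- Uℚ t h)
  odd t = trans (proj₂ (Uℚ-double t h))
    (solve 2 (λ a b → b :* b :- a :* a := (a :+ b) :* (b :- a)) refl (Uℚ t h) (Uℚ t (suc h)))
  even : ∀ t → Uℚ t (double (suc h)) ≡
    1ℚ ℚ.+ (Uℚ t h ℚ.+ Uℚ t (suc h)) ℚ.* (t ℚ.* Uℚ t (suc h) ℚ.- Uℚ t h ℚ.- Uℚ t (suc h))
  even t = trans (proj₁ (Uℚ-double t (suc h))) (trans
    (solve 3 (λ t a b → b :* ((t :* b :- a) :+ ((t :* b :- a) :- t :* b)) :=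
      (b :* b :+ a :* a :- t :* a :* b) :+ (a :+ b) :* (t :* b :- a :- b)) refl t (Uℚ t h) (Uℚ t (suc h)))
    (cong (ℚ._+ (Uℚ t h ℚ.+ Uℚ t (suc h)) ℚ.* (t ℚ.* Uℚ t (suc h) ℚ.- Uℚ t h ℚ.- Uℚ t (suc h)))
      (Uℚ-invariant t h)))

cyclicRoot : ∀ i → CyclicRoot (10 ℕ.+ i)
cyclicRoot i with halves i
... | h , inj₁ refl = cyclicRoot-even (5 ℕ.+ h) (negativeAt h)
... | h , inj₂ refl = cyclicRoot-odd (5 ℕ.+ h) (negativeAt h)

open Graph using (_~_; _~?_; ~-irr)
open ≈-Reasoning
open import Algebra.Properties.Semiring.Sum R.semiring
  using (sum-cong-≋; ∑-distrib-+; *-distribˡ-sum; *-distribʳ-sum; sum-permute; sum-replicate-zero)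

-- Determinants

sum-zero : ∀ {n} {f : Fin n → ℝ} → (∀ i → f i ≈ 0ℝ) → sum f ≈ 0ℝ
sum-zero {n} f≈0 = ≈-trans (sum-cong-≋ f≈0) (sum-replicate-zero n)

det-cong : ∀ {n} (M N : Matrix n) → (∀ i j → M i j ≈ N i j) → det M ≈ det N
det-cong {zero}  M N M≈N = ≈-refl
det-cong {suc n} M N M≈N = sum-cong-≋ λ j → *-cong
  (*-congˡ {(- 1ℝ) ^ toℕ j} (M≈N zero j))
  (det-cong (λ a b → M (suc a) (punchIn j b)) (λ a b → N (suc a) (punchIn j b))
    λ a b → M≈N (suc a) (punchIn j b))

swapAt : ∀ {n} → Fin n → Fin (suc n) → Fin (suc n)
swapAt zero    zero          = suc zero
swapAt zero    (suc zero)    = zero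
swapAt zero    (suc (suc c)) = suc (suc c)
swapAt (suc j) zero          = zero
swapAt (suc j) (suc c)       = suc (swapAt j c)

swapAt-involutive : ∀ {n} (j : Fin n) c → swapAt j (swapAt j c) ≡ c
swapAt-involutive zero    zero          = refl
swapAt-involutive zero    (suc zero)    = refl
swapAt-involutive zero    (suc (suc c)) = refl
swapAt-involutive (suc j) zero          = refl
swapAt-involutive (suc j) (suc c)       = cong suc (swapAt-involutive j c)

swapAt-inject₁ : ∀ {n} (j : Fin n) → swapAt j (inject₁ j) ≡ suc j
swapAt-inject₁ zero    = refl
swapAt-inject₁ (suc j) = cong suc (swapAt-inject₁ j)

swapAt-permutation : ∀ {n} → Fin n → Permutation (suc n) (suc n)
swapAt-permutation j = permutation (swapAt j) (swapAt j) (swapAt-involutive j) (swapAt-involutive j)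

-- How deleting column c interacts with exchanging columns j and j + 1.
data SwapPunch {n} (j : Fin (suc n)) (c : Fin (suc (suc n))) : Set where
  fixed : swapAt j c ≡ c → (j′ : Fin n) →
          (∀ b → swapAt j (punchIn (swapAt j c) b) ≡ punchIn c (swapAt j′ b)) → SwapPunch j c
  moved : toℕ (swapAt j c) ≡ suc (toℕ c) ⊎ toℕ c ≡ suc (toℕ (swapAt j c)) →
          (∀ b → swapAt j (punchIn (swapAt j c) b) ≡ punchIn c b) → SwapPunch j c

swapPunch : ∀ {n} (j : Fin (suc n)) c → SwapPunch j c
swapPunch zero zero = moved (inj₁ refl) λ { zero → refl ; (suc b) → refl }
swapPunch zero (suc zero) = moved (inj₂ refl) λ { zero → refl ; (suc b) → refl }
swapPunch {suc n} zero (suc (suc c)) = fixed refl zero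
  λ { zero → refl ; (suc zero) → refl ; (suc (suc b)) → refl }
swapPunch (suc j) zero = fixed refl j λ b → refl
swapPunch {suc n} (suc j) (suc c) with swapPunch j c
... | fixed eq j′ h = fixed (cong suc eq) (suc j′) λ { zero → refl ; (suc b) → cong suc (h b) }
... | moved (inj₁ eq) h = moved (inj₁ (cong suc eq)) λ { zero → refl ; (suc b) → cong suc (h b) }
... | moved (inj₂ eq) h = moved (inj₂ (cong suc eq)) λ { zero → refl ; (suc b) → cong suc (h b) }

≡⇒≈ : ∀ {x y : ℝ} → x ≡ y → x ≈ y
≡⇒≈ refl = ≈-refl

sign-suc : ∀ {m n} → m ≡ suc n ⊎ n ≡ suc m → (- 1ℝ) ^ m ≈ - 1ℝ * (- 1ℝ) ^ n
sign-suc (inj₁ refl) = ≈-refl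
sign-suc {m} (inj₂ refl) = pointwise λ k →
  solve 1 (λ s → s := :- con 1ℚ :* (:- con 1ℚ :* s)) refl (seq ((- 1ℝ) ^ m) k)

-- After reindexing the expansion by the exchange, terms correspond one to one. For an exchanged
-- column the minors agree and the sign flips; for any other column the sign stays and the minor
-- itself has two adjacent columns exchanged, so induction applies.
det-swap : ∀ {n} (j : Fin (suc n)) (M : Matrix (suc (suc n))) →
           det (λ a b → M a (swapAt j b)) ≈ - 1ℝ * det M
det-swap {n} j M = begin
  sum (term M′)                        ≈⟨ sum-permute (term M′) (swapAt-permutation j) ⟩
  sum (λ c → term M′ (swapAt j c))     ≈⟨ sum-cong-≋ (λ c → negated c (swapPunch j c)) ⟩
  sum (λ c → - 1ℝ * term M c)          ≈⟨ *-distribˡ-sum (- 1ℝ) (term M) ⟨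
  - 1ℝ * sum (term M)                  ∎
  where
  M′ : Matrix (suc (suc n))
  M′ a b = M a (swapAt j b)
  minor : Matrix (suc (suc n)) → Fin (suc (suc n)) → Matrix (suc n)
  minor A c a b = A (suc a) (punchIn c b)
  term : Matrix (suc (suc n)) → Fin (suc (suc n)) → ℝ
  term A c = (- 1ℝ) ^ toℕ c * A zero c * det (minor A c)
  entry : ∀ c → M′ zero (swapAt j c) ≈ M zero c
  entry c = ≡⇒≈ (cong (M zero) (swapAt-involutive j c))
  move-sign-right : ∀ s e d → s * e * (- 1ℝ * d) ≈ - 1ℝ * (s * e * d)
  move-sign-right s e d = pointwise λ k →
    solve 3 (λ s e d → s :* e :* (:- con 1ℚ :* d) := :- con 1ℚ :* (s :* e :* d)) refl
      (seq s k) (seq e k) (seq d k)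
  move-sign-left : ∀ s e d → - 1ℝ * s * e * d ≈ - 1ℝ * (s * e * d)
  move-sign-left s e d = pointwise λ k →
    solve 3 (λ s e d → :- con 1ℚ :* s :* e :* d := :- con 1ℚ :* (s :* e :* d)) refl
      (seq s k) (seq e k) (seq d k)
  -- Matching on n exposes the second successor in the size of the minor, which an inhabitant of
  -- `Fin n` guarantees.
  minor-swap : ∀ {n} (j′ : Fin n) (A : Matrix (suc n)) → det (λ a b → A a (swapAt j′ b)) ≈ - 1ℝ * det A
  minor-swap {suc n} j′ A = det-swap j′ A
  negated : ∀ c → SwapPunch j c → term M′ (swapAt j c) ≈ - 1ℝ * term M c
  negated c (fixed eq j′ h) = begin
    term M′ (swapAt j c)
      ≈⟨ *-cong (*-cong (≡⇒≈ (cong (λ c → (- 1ℝ) ^ toℕ c) eq)) (entry c))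
                (det-cong (minor M′ (swapAt j c)) (λ a b → minor M c a (swapAt j′ b))
                  λ a b → ≡⇒≈ (cong (M (suc a)) (h b))) ⟩
    (- 1ℝ) ^ toℕ c * M zero c * det (λ a b → minor M c a (swapAt j′ b))
      ≈⟨ *-congˡ {(- 1ℝ) ^ toℕ c * M zero c} (minor-swap j′ (minor M c)) ⟩
    (- 1ℝ) ^ toℕ c * M zero c * (- 1ℝ * det (minor M c))
      ≈⟨ move-sign-right ((- 1ℝ) ^ toℕ c) (M zero c) (det (minor M c)) ⟩
    - 1ℝ * term M c ∎
  negated c (moved eq h) = begin
    term M′ (swapAt j c)
      ≈⟨ *-cong (*-cong (sign-suc eq) (entry c))
                (det-cong (minor M′ (swapAt j c)) (minor M c) λ a b → ≡⇒≈ (cong (M (suc a)) (h b))) ⟩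
    - 1ℝ * (- 1ℝ) ^ toℕ c * M zero c * det (minor M c)
      ≈⟨ move-sign-left ((- 1ℝ) ^ toℕ c) (M zero c) (det (minor M c)) ⟩
    - 1ℝ * term M c ∎

x≈-x⇒x≈0 : ∀ {x} → x ≈ - 1ℝ * x → x ≈ 0ℝ
x≈-x⇒x≈0 {x} h = 0<y∧x*y≈0⇒x≈0 {x} {1ℝ + 1ℝ} (0<x+y 0<1 0<1) (begin
  x * (1ℝ + 1ℝ)    ≈⟨ pointwise (λ k → solve 1 (λ x → x :* (con 1ℚ :+ con 1ℚ) := x :+ x) refl (seq x k)) ⟩
  x + x            ≈⟨ +-cong ≈-refl h ⟩
  x + - 1ℝ * x     ≈⟨ pointwise (λ k → solve 1 (λ x → x :+ :- con 1ℚ :* x := con ℚ.0ℚ) refl (seq x k)) ⟩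
  0ℝ               ∎)
  where
  0<1 : 0ℝ < 1ℝ
  0<1 = fromℕ-mono-< {0} {1} (ℕ.s≤s ℕ.z≤n)

-- For adjacent equal columns the exchange fixes the matrix, so det M = -det M. Otherwise the copy
-- of column 0 is moved one place to the left at the cost of a sign.
det-alternating : ∀ {n} (j : Fin n) (M : Matrix (suc n)) → (∀ i → M i zero ≈ M i (suc j)) → det M ≈ 0ℝ
det-alternating {suc n} = <-weakInduction
  (λ j → ∀ M → (∀ i → M i zero ≈ M i (suc j)) → det M ≈ 0ℝ) base step
  where
  base : ∀ M → (∀ i → M i zero ≈ M i (suc zero)) → det M ≈ 0ℝ
  base M eq = x≈-x⇒x≈0 (≈-trans
    (det-cong M (λ a b → M a (swapAt zero b))
      λ { i zero → eq i ; i (suc zero) → ≈-sym (eq i) ; i (suc (suc b)) → ≈-refl })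
    (det-swap zero M))
  step : ∀ j → (∀ M → (∀ i → M i zero ≈ M i (suc (inject₁ j))) → det M ≈ 0ℝ) →
         ∀ M → (∀ i → M i zero ≈ M i (suc (suc j))) → det M ≈ 0ℝ
  step j ih M eq = 0≈-x⇒x≈0 (≈-trans (≈-sym (ih (λ a b → M a (swapAt (suc j) b)) λ i →
      ≈-trans (eq i) (≡⇒≈ (cong (λ c → M i (suc c)) (sym (swapAt-inject₁ j))))))
    (det-swap (suc j) M))
    where
    0≈-x⇒x≈0 : ∀ {x} → 0ℝ ≈ - 1ℝ * x → x ≈ 0ℝ
    0≈-x⇒x≈0 {x} h = begin
      x                   ≈⟨ pointwise (λ k → solve 1 (λ x → x := :- con 1ℚ :* (:- con 1ℚ :* x)) refl (seq x k)) ⟩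
      - 1ℝ * (- 1ℝ * x)   ≈⟨ *-congˡ { - 1ℝ} h ⟨
      - 1ℝ * 0ℝ           ≈⟨ R.zeroʳ (- 1ℝ) ⟩
      0ℝ                  ∎

-- A matrix with its first column singled out: linearity and repetition are needed for that column
-- only.
infixr 5 _∷ᶜ_
_∷ᶜ_ : ∀ {m n} → (Fin m → ℝ) → (Fin m → Fin n → ℝ) → Fin m → Fin (suc n) → ℝ
(w ∷ᶜ A) i zero    = w i
(w ∷ᶜ A) i (suc j) = A i j

sum-linear : ∀ {n} α {f g h : Fin n → ℝ} → (∀ i → h i ≈ α * f i + g i) → sum h ≈ α * sum f + sum g
sum-linear α {f} {g} h≈ = ≈-trans (sum-cong-≋ h≈) (≈-trans (∑-distrib-+ (λ i → α * f i) g)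
  (+-cong (≈-sym (*-distribˡ-sum α f)) ≈-refl))

private
  minorᶜ : ∀ {n} → (Fin (suc n) → ℝ) → (Fin (suc n) → Fin n → ℝ) → Fin (suc n) → Matrix n
  minorᶜ w A c a b = (w ∷ᶜ A) (suc a) (punchIn c b)

  minorᶜ-suc : ∀ {n} (w : Fin (suc (suc n)) → ℝ) (A : Fin (suc (suc n)) → Fin (suc n) → ℝ) j →
    det (minorᶜ w A (suc j)) ≈ det ((λ a → w (suc a)) ∷ᶜ (λ a b → A (suc a) (punchIn j b)))
  minorᶜ-suc w A j = det-cong (minorᶜ w A (suc j))
    ((λ a → w (suc a)) ∷ᶜ (λ a b → A (suc a) (punchIn j b)))
    λ { a zero → ≈-refl ; a (suc b) → ≈-refl }

-- Expansion along the first row meets the first column in two ways: the term at column 0 depends on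
-- it through the entry, every other term through its minor, where induction applies.
det-linear : ∀ {n} α (w w′ : Fin (suc n) → ℝ) (A : Fin (suc n) → Fin n → ℝ) →
             det ((λ i → α * w i + w′ i) ∷ᶜ A) ≈ α * det (w ∷ᶜ A) + det (w′ ∷ᶜ A)
det-linear {n} α w w′ A = sum-linear α (term n w w′ A)
  where
  distribute-entry : ∀ s x y d → s * (α * x + y) * d ≈ α * (s * x * d) + s * y * d
  distribute-entry s x y d = pointwise λ k →
    solve 5 (λ α s x y d → s :* (α :* x :+ y) :* d := α :* (s :* x :* d) :+ s :* y :* d) refl
      (seq α k) (seq s k) (seq x k) (seq y k) (seq d k)
  distribute-minor : ∀ s d d′ → s * (α * d + d′) ≈ α * (s * d) + s * d′
  distribute-minor s d d′ = pointwise λ k →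
    solve 4 (λ α s d d′ → s :* (α :* d :+ d′) := α :* (s :* d) :+ s :* d′) refl
      (seq α k) (seq s k) (seq d k) (seq d′ k)
  term : ∀ n (w w′ : Fin (suc n) → ℝ) (A : Fin (suc n) → Fin n → ℝ) c →
    (- 1ℝ) ^ toℕ c * ((λ i → α * w i + w′ i) ∷ᶜ A) zero c * det (minorᶜ (λ i → α * w i + w′ i) A c) ≈
    α * ((- 1ℝ) ^ toℕ c * (w ∷ᶜ A) zero c * det (minorᶜ w A c)) +
    (- 1ℝ) ^ toℕ c * (w′ ∷ᶜ A) zero c * det (minorᶜ w′ A c)
  term n w w′ A zero = distribute-entry 1ℝ (w zero) (w′ zero) (det (λ a b → A (suc a) b))
  term (suc n) w w′ A (suc j) = begin
    s * det (minorᶜ (λ i → α * w i + w′ i) A (suc j))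
      ≈⟨ *-congˡ {s} (minorᶜ-suc (λ i → α * w i + w′ i) A j) ⟩
    s * det ((λ a → α * w (suc a) + w′ (suc a)) ∷ᶜ A′)
      ≈⟨ *-congˡ {s} (det-linear α (λ a → w (suc a)) (λ a → w′ (suc a)) A′) ⟩
    s * (α * det ((λ a → w (suc a)) ∷ᶜ A′) + det ((λ a → w′ (suc a)) ∷ᶜ A′))
      ≈⟨ *-congˡ {s} (+-cong (*-congˡ {α} (minorᶜ-suc w A j)) (minorᶜ-suc w′ A j)) ⟨
    s * (α * det (minorᶜ w A (suc j)) + det (minorᶜ w′ A (suc j)))
      ≈⟨ distribute-minor s (det (minorᶜ w A (suc j))) (det (minorᶜ w′ A (suc j))) ⟩
    α * (s * det (minorᶜ w A (suc j))) + s * det (minorᶜ w′ A (suc j)) ∎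
    where
    s = (- 1ℝ) ^ toℕ (suc j) * A zero j
    A′ : Fin (suc n) → Fin n → ℝ
    A′ a b = A (suc a) (punchIn j b)

-- From 0 = 1 · 0 + 0, linearity gives d = d + d.
det-∷ᶜ-zero : ∀ {n} (A : Fin (suc n) → Fin n → ℝ) → det ((λ _ → 0ℝ) ∷ᶜ A) ≈ 0ℝ
det-∷ᶜ-zero A = begin
  d                 ≈⟨ R.+-identityʳ d ⟨
  d + 0ℝ            ≈⟨ +-cong ≈-refl (R.-‿inverseʳ d) ⟨
  d + (d - d)       ≈⟨ pointwise (λ k → solve 1 (λ d → d :+ (d :- d) := (con 1ℚ :* d :+ d) :- d) refl (seq d k)) ⟩
  (1ℝ * d + d) - d  ≈⟨ +-cong (det-linear 1ℝ (λ _ → 0ℝ) (λ _ → 0ℝ) A) ≈-refl ⟨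
  det ((λ _ → 1ℝ * 0ℝ + 0ℝ) ∷ᶜ A) - d
    ≈⟨ +-cong (det-cong ((λ _ → 1ℝ * 0ℝ + 0ℝ) ∷ᶜ A) ((λ _ → 0ℝ) ∷ᶜ A)
         λ { i zero → pointwise (λ _ → refl) ; i (suc j) → ≈-refl }) ≈-refl ⟩
  d - d             ≈⟨ R.-‿inverseʳ d ⟩
  0ℝ                ∎
  where
  d = det ((λ _ → 0ℝ) ∷ᶜ A)

det-sum : ∀ {n} m (u : Fin m → ℝ) (W : Fin m → Fin (suc n) → ℝ) (A : Fin (suc n) → Fin n → ℝ) →
          det ((λ i → sum λ j → u j * W j i) ∷ᶜ A) ≈ sum (λ j → u j * det (W j ∷ᶜ A))
det-sum zero    u W A = det-∷ᶜ-zero A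
det-sum (suc m) u W A = ≈-trans
  (det-linear (u zero) (W zero) (λ i → sum λ j → u (suc j) * W (suc j) i) A)
  (+-cong ≈-refl (det-sum m (λ j → u (suc j)) (λ j → W (suc j)) A))

-- Replacing the first column by the combination Mu = 0 gives determinant 0. Expanded by linearity,
-- it is u₀ det M plus terms with a repeated column, so u₀ = 1 leaves det M.
kernel⇒det≈0 : ∀ {n} (M : Matrix (suc n)) (u : Fin (suc n) → ℝ) →
               (∀ i → sum (λ j → M i j * u j) ≈ 0ℝ) → u zero ≈ 1ℝ → det M ≈ 0ℝ
kernel⇒det≈0 {n} M u Mu≈0 u₀≈1 = begin
  det M                         ≈⟨ R.*-identityˡ (det M) ⟨
  1ℝ * det M
    ≈⟨ *-cong u₀≈1 (det-cong (column zero ∷ᶜ A) M λ { i zero → ≈-refl ; i (suc j) → ≈-refl }) ⟨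
  u zero * det (column zero ∷ᶜ A)
    ≈⟨ R.+-identityʳ (u zero * det (column zero ∷ᶜ A)) ⟨
  u zero * det (column zero ∷ᶜ A) + 0ℝ
    ≈⟨ +-cong ≈-refl (sum-zero {f = λ j → u (suc j) * det (column (suc j) ∷ᶜ A)} λ j →
         ≈-trans (*-congˡ {u (suc j)} (det-alternating j (column (suc j) ∷ᶜ A) λ i → ≈-refl))
                 (R.zeroʳ (u (suc j)))) ⟨
  sum (λ j → u j * det (column j ∷ᶜ A))                ≈⟨ det-sum (suc n) u column A ⟨
  det ((λ i → sum λ j → u j * M i j) ∷ᶜ A)
    ≈⟨ det-cong ((λ i → sum λ j → u j * M i j) ∷ᶜ A) ((λ _ → 0ℝ) ∷ᶜ A)
         (λ { i zero → ≈-trans (sum-cong-≋ {suc n} {λ j → u j * M i j} {λ j → M i j * u j}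
                                    λ j → *-comm (u j) (M i j)) (Mu≈0 i)
            ; i (suc j) → ≈-refl }) ⟩
  det ((λ _ → 0ℝ) ∷ᶜ A)         ≈⟨ det-∷ᶜ-zero A ⟩
  0ℝ                            ∎
  where
  A : Fin (suc n) → Fin n → ℝ
  A i j = M i (suc j)
  column : Fin (suc n) → Fin (suc n) → ℝ
  column j i = M i j

-- Adjacency sums in Cartesian products

indicator : ∀ {P : Set} → Dec P → ℝ
indicator (yes _) = 1ℝ
indicator (no  _) = 0ℝ

indicator-⇔ : ∀ {P Q : Set} (P? : Dec P) (Q? : Dec Q) → (P → Q) → (Q → P) → indicator P? ≈ indicator Q?
indicator-⇔ (yes p) (yes q) f g = ≈-refl
indicator-⇔ (yes p) (no ¬q) f g = contradiction (f p) ¬q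
indicator-⇔ (no ¬p) (yes q) f g = contradiction (g q) ¬p
indicator-⇔ (no ¬p) (no ¬q) f g = ≈-refl

indicator-× : ∀ {P Q : Set} (P? : Dec P) (Q? : Dec Q) → indicator (P? ×-dec Q?) ≈ indicator P? * indicator Q?
indicator-× (yes p) (yes q) = ≈-sym (R.*-identityˡ 1ℝ)
indicator-× (yes p) (no ¬q) = ≈-sym (R.zeroʳ 1ℝ)
indicator-× (no ¬p) (yes q) = ≈-sym (R.zeroˡ 1ℝ)
indicator-× (no ¬p) (no ¬q) = ≈-sym (R.zeroʳ 0ℝ)

indicator-⊎ : ∀ {P Q : Set} (P? : Dec P) (Q? : Dec Q) → ¬ (P × Q) →
              indicator (P? ⊎-dec Q?) ≈ indicator P? + indicator Q?
indicator-⊎ (yes p) (yes q) ¬pq = contradiction (p , q) ¬pq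
indicator-⊎ (yes p) (no ¬q) ¬pq = ≈-sym (R.+-identityʳ 1ℝ)
indicator-⊎ (no ¬p) (yes q) ¬pq = ≈-sym (R.+-identityˡ 1ℝ)
indicator-⊎ (no ¬p) (no ¬q) ¬pq = ≈-sym (R.+-identityˡ 0ℝ)

sum-indicator : ∀ {n} (i : Fin n) (f : Fin n → ℝ) → sum (λ j → indicator (i Fin.≟ j) * f j) ≈ f i
sum-indicator {suc n} zero f = begin
  1ℝ * f zero + sum (λ j → 0ℝ * f (suc j))
    ≈⟨ +-cong (R.*-identityˡ (f zero)) (sum-zero {f = λ j → 0ℝ * f (suc j)} λ j → R.zeroˡ (f (suc j))) ⟩
  f zero + 0ℝ    ≈⟨ R.+-identityʳ (f zero) ⟩
  f zero         ∎
sum-indicator {suc n} (suc i) f = begin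
  0ℝ * f zero + sum (λ j → indicator (suc i Fin.≟ suc j) * f (suc j))
    ≈⟨ +-cong (R.zeroˡ (f zero)) (sum-cong-≋ {n} λ j →
         *-cong (indicator-⇔ (suc i Fin.≟ suc j) (i Fin.≟ j) Fin.suc-injective (cong suc)) ≈-refl) ⟩
  0ℝ + sum (λ j → indicator (i Fin.≟ j) * f (suc j))
    ≈⟨ R.+-identityˡ (sum λ j → indicator (i Fin.≟ j) * f (suc j)) ⟩
  sum (λ j → indicator (i Fin.≟ j) * f (suc j))   ≈⟨ sum-indicator i (λ j → f (suc j)) ⟩
  f (suc i)      ∎

sum-↑ : ∀ m {n} (f : Fin (m ℕ.+ n) → ℝ) → sum f ≈ sum (λ i → f (i ↑ˡ n)) + sum (λ j → f (m ↑ʳ j))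
sum-↑ zero    f = ≈-sym (R.+-identityˡ (sum f))
sum-↑ (suc m) {n} f = ≈-trans (+-cong ≈-refl (sum-↑ m (λ i → f (suc i))))
  (≈-sym (R.+-assoc (f zero) (sum (λ i → f (suc (i ↑ˡ n)))) (sum (λ j → f (suc (m ↑ʳ j))))))

sum-combine : ∀ m {n} (f : Fin (m ℕ.* n) → ℝ) → sum f ≈ sum (λ i → sum λ j → f (combine {m} {n} i j))
sum-combine zero    f = ≈-refl
sum-combine (suc m) {n} f = ≈-trans (sum-↑ n {m ℕ.* n} f)
  (+-cong ≈-refl (sum-combine m {n} (λ p → f (n ↑ʳ p))))

sum-remQuot : ∀ {m n} (f : Fin m × Fin n → ℝ) →
              sum (λ p → f (remQuot {m} n p)) ≈ sum (λ i → sum λ j → f (i , j))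
sum-remQuot {m} {n} f = ≈-trans (sum-combine m {n} (λ p → f (remQuot {m} n p)))
  (sum-cong-≋ {m} λ i → sum-cong-≋ {n} λ j → ≡⇒≈ (cong f (Fin.remQuot-combine i j)))

fromℕ-suc : ∀ n → fromℕ (suc n) ≈ 1ℝ + fromℕ n
fromℕ-suc n = pointwise λ _ → ℕ→ℚ-suc n

-- General f, because the tail of `allFin` is a `tabulate` of `suc`.
count-tabulate : ∀ {A : Set} {P : Pred A 0ℓ} (P? : Decidable P) {n} (f : Fin n → A) →
  fromℕ (length (filter P? (tabulate f))) ≈ sum (λ i → indicator (P? (f i)))
count-tabulate P? {zero}  f = ≈-refl
count-tabulate P? {suc n} f with P? (f zero)
... | yes _ = ≈-trans (fromℕ-suc (length (filter P? (tabulate (λ i → f (suc i))))))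
                      (+-cong ≈-refl (count-tabulate P? (λ i → f (suc i))))
... | no  _ = ≈-trans (count-tabulate P? (λ i → f (suc i)))
                      (≈-sym (R.+-identityˡ (sum λ i → indicator (P? (f (suc i))))))

adjacency-indicator : ∀ {v} (G : Graph v) i j → adjacency G i j ≈ indicator (_~?_ G i j)
adjacency-indicator G i j with _~?_ G i j
... | yes _ = ≈-refl
... | no  _ = ≈-refl

degree≈sum : ∀ {v} (G : Graph v) i → fromℕ (degree G i) ≈ sum (adjacency G i)
degree≈sum G i = ≈-trans (count-tabulate (_~?_ G i) (λ j → j))
  (sum-cong-≋ λ j → ≈-sym (adjacency-indicator G i j))

filter-filter : ∀ {A : Set} {P Q : Pred A 0ℓ} (P? : Decidable P) (Q? : Decidable Q) →
                (∀ x → Q x → P x) → ∀ xs → filter Q? (filter P? xs) ≡ filter Q? xs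
filter-filter P? Q? Q⊆P [] = refl
filter-filter P? Q? Q⊆P (x ∷ xs) with P? x
... | no ¬p with Q? x
...   | yes q = contradiction (Q⊆P x q) ¬p
...   | no  _ = filter-filter P? Q? Q⊆P xs
filter-filter P? Q? Q⊆P (x ∷ xs) | yes _ with Q? x
...   | yes _ = cong (x ∷_) (filter-filter P? Q? Q⊆P xs)
...   | no  _ = filter-filter P? Q? Q⊆P xs

count-< : ∀ {n} {P Q : Pred (Fin n) 0ℓ} (P? : Decidable P) (Q? : Decidable Q) → (∀ x → Q x → P x) →
          ∀ r → P r → ¬ Q r → length (filter Q? (allFin n)) ℕ.< length (filter P? (allFin n))
count-< {n} P? Q? Q⊆P r Pr ¬Qr = subst (ℕ._< length (filter P? (allFin n)))
  (cong length (filter-filter P? Q? Q⊆P (allFin n)))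
  (filter-notAll Q? (filter P? (allFin n)) (lose (∈-filter⁺ P? (∈-allFin r) Pr) ¬Qr))

-- Two strict inclusions: the neighbours of p, those other than r, and the common neighbours of p
-- and q, which also miss r′.
edgeDegree+2≤degree : ∀ {v} (G : Graph v) {p q r r′} → r ≢ r′ → _~_ G p r → _~_ G p r′ →
  ¬ _~_ G q r → ¬ _~_ G q r′ → 2 ℕ.+ edgeDegree G (p , q) ℕ.≤ degree G p
edgeDegree+2≤degree G {p} {q} {r} {r′} r≢r′ p~r p~r′ q≁r q≁r′ = ℕ.≤-trans
  (ℕ.s≤s (count-< minus? (λ h → (_~?_ G p h) ×-dec (_~?_ G q h))
    (λ h (p~h , q~h) → p~h , λ r≡h → q≁r (subst (_~_ G q) (sym r≡h) q~h))
    r′ (p~r′ , r≢r′) (q≁r′ ∘ proj₂)))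
  (count-< (_~?_ G p) minus? (λ _ → proj₁) r p~r λ (_ , r≢r) → r≢r refl)
  where
  minus? : Decidable (λ h → _~_ G p h × r ≢ h)
  minus? h = (_~?_ G p h) ×-dec ¬? (r Fin.≟ h)

λmax≤ : ∀ {v} (G : Graph v) {b} → (∀ p q → _~_ G p q → edgeDegree G (p , q) ℕ.≤ b) → λmax G ℕ.≤ b
λmax≤ {v} G bound = Extrema.max≤v⁺ {xs = map (edgeDegree G) (edges G)} ℕ.z≤n
  (All.map⁺ (All.map (λ { {p , q} → bound p q })
    (All.all-filter (λ (i , j) → _~?_ G i j) (cartesianProduct (allFin v) (allFin v)))))

-- Next on numbers rather than on Fin n, so that its equations can be matched with refl.
NextValue : ℕ → ℕ → ℕ → Set
NextValue n i j = j ≡ suc i ⊎ (suc i ≡ n × j ≡ 0)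

no-1-cycle : ∀ {n i} → 2 ℕ.≤ n → ¬ NextValue n i i
no-1-cycle _ (inj₁ ())
no-1-cycle (ℕ.s≤s ()) (inj₂ (refl , refl))

no-2-cycle : ∀ {n i j} → 3 ℕ.≤ n → NextValue n i j → ¬ NextValue n j i
no-2-cycle _ (inj₁ refl) (inj₁ ())
no-2-cycle (ℕ.s≤s (ℕ.s≤s ())) (inj₁ refl) (inj₂ (refl , refl))
no-2-cycle (ℕ.s≤s (ℕ.s≤s ())) (inj₂ (refl , refl)) (inj₁ refl)

no-3-cycle : ∀ {n i j l} → 4 ℕ.≤ n → NextValue n i j → NextValue n j l → ¬ NextValue n l i
no-3-cycle _ (inj₁ refl) (inj₁ refl) (inj₁ ())
no-3-cycle (ℕ.s≤s (ℕ.s≤s (ℕ.s≤s ()))) (inj₁ refl) (inj₁ refl) (inj₂ (refl , refl))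
no-3-cycle (ℕ.s≤s (ℕ.s≤s (ℕ.s≤s ()))) (inj₁ refl) (inj₂ (refl , refl)) (inj₁ refl)
no-3-cycle (ℕ.s≤s (ℕ.s≤s (ℕ.s≤s ()))) (inj₂ (refl , refl)) (inj₁ refl) (inj₁ refl)

module _ {n : ℕ} where

  Next-functional : ∀ {i j l : Fin n} → Next i j → Next i l → j ≡ l
  Next-functional (inj₁ p) (inj₁ q) = Fin.toℕ-injective (trans p (sym q))
  Next-functional {j = j} (inj₁ p) (inj₂ (q , _)) = contradiction (trans p q) (ℕ.<⇒≢ (Fin.toℕ<n j))
  Next-functional {l = l} (inj₂ (p , _)) (inj₁ q) = contradiction (trans q p) (ℕ.<⇒≢ (Fin.toℕ<n l))
  Next-functional (inj₂ (_ , p)) (inj₂ (_ , q)) = Fin.toℕ-injective (trans p (sym q))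

  Next-injective : ∀ {i j l : Fin n} → Next i l → Next j l → i ≡ j
  Next-injective (inj₁ p) (inj₁ q) = Fin.toℕ-injective (ℕ.suc-injective (trans (sym p) q))
  Next-injective (inj₁ p) (inj₂ (_ , q)) = contradiction (trans (sym p) q) λ ()
  Next-injective (inj₂ (_ , p)) (inj₁ q) = contradiction (trans (sym q) p) λ ()
  Next-injective (inj₂ (p , _)) (inj₂ (q , _)) = Fin.toℕ-injective (ℕ.suc-injective (trans p (sym q)))

successor : ∀ {n} (i : Fin n) → ∃[ j ] Next i j
successor {suc n} i with suc (toℕ i) ℕ.<? suc n
... | yes 1+i<n = fromℕ< 1+i<n , inj₁ (Fin.toℕ-fromℕ< 1+i<n)
... | no  1+i≮n = zero , inj₂ (ℕ.≤-antisym (Fin.toℕ<n i) (ℕ.≮⇒≥ 1+i≮n) , refl)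

predecessor : ∀ {n} (j : Fin n) → ∃[ i ] Next i j
predecessor {suc n} zero    = Fin.fromℕ n , inj₂ (cong suc (Fin.toℕ-fromℕ n) , refl)
predecessor {suc n} (suc j) = Fin.inject₁ j , inj₁ (cong suc (sym (Fin.toℕ-inject₁ j)))

cycle-adjacent : ∀ {n} → 2 ℕ.≤ n → ∀ {i j : Fin n} → Next i j ⊎ Next j i → _~_ (cycle n) i j
cycle-adjacent 2≤n next = (λ { refl → no-1-cycle 2≤n (Sum.reduce next) }) , next

module CycleNeighbours {n} (3≤n : 3 ℕ.≤ n) (i : Fin n) where

  next prev : Fin n
  next = proj₁ (successor i)
  prev = proj₁ (predecessor i)

  next≢prev : next ≢ prev
  next≢prev eq = no-2-cycle 3≤n (proj₂ (successor i)) (subst (λ j → Next j i) (sym eq) (proj₂ (predecessor i)))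

  -- Vertex j carries f (j + 1), so the predecessor of vertex 0 corresponds to f 0 and no negative
  -- index arises. The two hypotheses account for the wrap-around, one at each end.
  cycle-row : ∀ (f : ℕ → ℝ) → f n ≈ f 0 → f (suc n) ≈ f 1 →
              sum (λ j → adjacency (cycle n) i j * f (suc (toℕ j))) ≈ f (suc (suc (toℕ i))) + f (toℕ i)
  cycle-row f fn≈f0 f1+n≈f1 = begin
    sum (λ j → adjacency (cycle n) i j * g j)
      ≈⟨ sum-cong-≋ (λ j → ≈-trans (*-cong (entry j) ≈-refl)
           (R.distribʳ (g j) (indicator (next Fin.≟ j)) (indicator (prev Fin.≟ j)))) ⟩
    sum (λ j → indicator (next Fin.≟ j) * g j + indicator (prev Fin.≟ j) * g j)
      ≈⟨ ∑-distrib-+ (λ j → indicator (next Fin.≟ j) * g j) (λ j → indicator (prev Fin.≟ j) * g j) ⟩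
    sum (λ j → indicator (next Fin.≟ j) * g j) + sum (λ j → indicator (prev Fin.≟ j) * g j)
      ≈⟨ +-cong (sum-indicator next g) (sum-indicator prev g) ⟩
    g next + g prev
      ≈⟨ +-cong (at-next (proj₂ (successor i))) (at-prev (proj₂ (predecessor i))) ⟩
    f (suc (suc (toℕ i))) + f (toℕ i) ∎
    where
    g : Fin n → ℝ
    g j = f (suc (toℕ j))
    forward : ∀ {j} → _~_ (cycle n) i j → next ≡ j ⊎ prev ≡ j
    forward (_ , inj₁ i→j) = inj₁ (Next-functional (proj₂ (successor i)) i→j)
    forward (_ , inj₂ j→i) = inj₂ (Next-injective (proj₂ (predecessor i)) j→i)
    backward : ∀ {j} → next ≡ j ⊎ prev ≡ j → _~_ (cycle n) i j
    backward (inj₁ refl) = cycle-adjacent (ℕ.≤-trans (ℕ.n≤1+n 2) 3≤n) (inj₁ (proj₂ (successor i)))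
    backward (inj₂ refl) = cycle-adjacent (ℕ.≤-trans (ℕ.n≤1+n 2) 3≤n) (inj₂ (proj₂ (predecessor i)))
    entry : ∀ j → adjacency (cycle n) i j ≈ indicator (next Fin.≟ j) + indicator (prev Fin.≟ j)
    entry j = begin
      adjacency (cycle n) i j
        ≈⟨ adjacency-indicator (cycle n) i j ⟩
      indicator (_~?_ (cycle n) i j)
        ≈⟨ indicator-⇔ (_~?_ (cycle n) i j) ((next Fin.≟ j) ⊎-dec (prev Fin.≟ j)) forward backward ⟩
      indicator ((next Fin.≟ j) ⊎-dec (prev Fin.≟ j))
        ≈⟨ indicator-⊎ (next Fin.≟ j) (prev Fin.≟ j) (λ (p , q) → next≢prev (trans p (sym q))) ⟩
      indicator (next Fin.≟ j) + indicator (prev Fin.≟ j) ∎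
    at-next : ∀ {j : Fin n} → Next i j → f (suc (toℕ j)) ≈ f (suc (suc (toℕ i)))
    at-next (inj₁ p) = ≡⇒≈ (cong (f ∘ suc) p)
    at-next (inj₂ (p , q)) = ≈-trans (≡⇒≈ (cong (f ∘ suc) q))
      (≈-trans (≈-sym f1+n≈f1) (≡⇒≈ (cong (f ∘ suc) (sym p))))
    at-prev : ∀ {j : Fin n} → Next j i → f (suc (toℕ j)) ≈ f (toℕ i)
    at-prev (inj₁ p) = ≡⇒≈ (cong f (sym p))
    at-prev (inj₂ (p , q)) = ≈-trans (≡⇒≈ (cong f p)) (≈-trans fn≈f0 (≡⇒≈ (cong f (sym q))))

-- Orient the three edges by `Next`. Either they form a directed 3-cycle, for which n ≥ 4 is too
-- long, or two of them leave or enter the same vertex and two corners coincide.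
cycle-triangle-free : ∀ {n} → 4 ℕ.≤ n → ∀ {i j l} →
  _~_ (cycle n) i j → _~_ (cycle n) j l → ¬ _~_ (cycle n) i l
cycle-triangle-free 4≤n (_ , inj₁ i→j) (_ , inj₁ j→l) (_ , inj₂ l→i) = no-3-cycle 4≤n i→j j→l l→i
cycle-triangle-free 4≤n (_ , inj₂ j→i) (_ , inj₂ l→j) (_ , inj₁ i→l) = no-3-cycle 4≤n l→j j→i i→l
cycle-triangle-free _ (_ , inj₁ i→j) (j≢l , inj₁ _) (_ , inj₁ i→l) = j≢l (Next-functional i→j i→l)
cycle-triangle-free _ (_ , inj₁ i→j) (_ , inj₂ l→j) (i≢l , _) = i≢l (Next-injective i→j l→j)
cycle-triangle-free _ (_ , inj₂ j→i) (_ , inj₁ j→l) (i≢l , _) = i≢l (Next-functional j→i j→l)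
cycle-triangle-free _ (i≢j , inj₂ _) (_ , inj₂ l→j) (_ , inj₂ l→i) = i≢j (Next-functional l→i l→j)

-- Adjacency matrix of a product

module □-Rows {m} (Γ : Graph m) {n : ℕ} (H : Graph n) where

  fst : Fin (m ℕ.* n) → Fin m
  fst p = proj₁ (remQuot {m} n p)

  snd : Fin (m ℕ.* n) → Fin n
  snd p = proj₂ (remQuot {m} n p)

  -- The matrix is I ⊗ A(H) + A(Γ) ⊗ I; the indicators add because H has no loops, which keeps the
  -- two kinds of edges apart.
  □-entry : ∀ p q → adjacency (Γ □ H) p q ≈
    indicator (fst p Fin.≟ fst q) * adjacency H (snd p) (snd q) +
    indicator (snd p Fin.≟ snd q) * adjacency Γ (fst p) (fst q)
  □-entry p q = begin
    adjacency (Γ □ H) p q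
      ≈⟨ adjacency-indicator (Γ □ H) p q ⟩
    indicator (P? ⊎-dec Q?)
      ≈⟨ indicator-⊎ P? Q? (λ ((_ , b~d) , (b≡d , _)) → ~-irr H (subst (_~_ H (snd p)) (sym b≡d) b~d)) ⟩
    indicator P? + indicator Q?
      ≈⟨ +-cong (indicator-× (fst p Fin.≟ fst q) (_~?_ H (snd p) (snd q)))
                (indicator-× (snd p Fin.≟ snd q) (_~?_ Γ (fst p) (fst q))) ⟩
    indicator (fst p Fin.≟ fst q) * indicator (_~?_ H (snd p) (snd q)) +
    indicator (snd p Fin.≟ snd q) * indicator (_~?_ Γ (fst p) (fst q))
      ≈⟨ +-cong (*-congˡ {indicator (fst p Fin.≟ fst q)} (adjacency-indicator H (snd p) (snd q)))
                (*-congˡ {indicator (snd p Fin.≟ snd q)} (adjacency-indicator Γ (fst p) (fst q))) ⟨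
    indicator (fst p Fin.≟ fst q) * adjacency H (snd p) (snd q) +
    indicator (snd p Fin.≟ snd q) * adjacency Γ (fst p) (fst q) ∎
    where
    P? = (fst p Fin.≟ fst q) ×-dec (_~?_ H (snd p) (snd q))
    Q? = (snd p Fin.≟ snd q) ×-dec (_~?_ Γ (fst p) (fst q))

  -- On functions of the second coordinate alone, Γ acts as multiplication by its row sum k.
  □-row : ∀ {k} → IsRegular Γ k → ∀ p (g : Fin n → ℝ) →
    sum (λ q → adjacency (Γ □ H) p q * g (snd q)) ≈
    sum (λ j → adjacency H (snd p) j * g j) + fromℕ k * g (snd p)
  □-row {k} regular p g = begin
    sum (λ q → adjacency (Γ □ H) p q * g (snd q))
      ≈⟨ sum-cong-≋ {m ℕ.* n} (λ q → *-cong (□-entry p q) ≈-refl) ⟩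
    sum (λ q → (δ₁ (fst q) * AH (snd q) + δ₂ (snd q) * AΓ (fst q)) * g (snd q))
      ≈⟨ sum-remQuot {m} {n} (λ (i , j) → (δ₁ i * AH j + δ₂ j * AΓ i) * g j) ⟩
    sum (λ i → sum λ j → (δ₁ i * AH j + δ₂ j * AΓ i) * g j)
      ≈⟨ sum-cong-≋ {m} (λ i → column i) ⟩
    sum (λ i → δ₁ i * sum (λ j → AH j * g j) + AΓ i * g b)
      ≈⟨ ∑-distrib-+ (λ i → δ₁ i * sum (λ j → AH j * g j)) (λ i → AΓ i * g b) ⟩
    sum (λ i → δ₁ i * sum (λ j → AH j * g j)) + sum (λ i → AΓ i * g b)
      ≈⟨ +-cong (sum-indicator (fst p) (λ _ → sum (λ j → AH j * g j))) (≈-sym (*-distribʳ-sum (g b) AΓ)) ⟩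
    sum (λ j → AH j * g j) + sum AΓ * g b
      ≈⟨ +-cong ≈-refl (*-cong (≈-trans (≈-sym (degree≈sum Γ (fst p))) (≡⇒≈ (cong fromℕ (regular (fst p))))) ≈-refl) ⟩
    sum (λ j → AH j * g j) + fromℕ k * g b ∎
    where
    b = snd p
    δ₁ = λ i → indicator (fst p Fin.≟ i)
    δ₂ = λ j → indicator (b Fin.≟ j)
    AH = adjacency H b
    AΓ = adjacency Γ (fst p)
    column : ∀ i → sum (λ j → (δ₁ i * AH j + δ₂ j * AΓ i) * g j) ≈ δ₁ i * sum (λ j → AH j * g j) + AΓ i * g b
    column i = begin
      sum (λ j → (δ₁ i * AH j + δ₂ j * AΓ i) * g j)
        ≈⟨ sum-cong-≋ {n} (λ j → ≈-trans (R.distribʳ (g j) (δ₁ i * AH j) (δ₂ j * AΓ i))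
             (+-cong (R.*-assoc (δ₁ i) (AH j) (g j))
                     (≈-trans (*-cong (*-comm (δ₂ j) (AΓ i)) ≈-refl) (R.*-assoc (AΓ i) (δ₂ j) (g j))))) ⟩
      sum (λ j → δ₁ i * (AH j * g j) + AΓ i * (δ₂ j * g j))
        ≈⟨ ∑-distrib-+ (λ j → δ₁ i * (AH j * g j)) (λ j → AΓ i * (δ₂ j * g j)) ⟩
      sum (λ j → δ₁ i * (AH j * g j)) + sum (λ j → AΓ i * (δ₂ j * g j))
        ≈⟨ +-cong (*-distribˡ-sum (δ₁ i) (λ j → AH j * g j)) (*-distribˡ-sum (AΓ i) (λ j → δ₂ j * g j)) ⟨
      δ₁ i * sum (λ j → AH j * g j) + AΓ i * sum (λ j → δ₂ j * g j)
        ≈⟨ +-cong ≈-refl (*-congˡ {AΓ i} (sum-indicator b g)) ⟩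
      δ₁ i * sum (λ j → AH j * g j) + AΓ i * g b ∎

-- The two bounds

<-≤-pointwise : ∀ {x y z} → x < y → (∀ n → seq y n ℚ.≤ seq z n) → x < z
<-≤-pointwise (mk< g 0<g sep) y≤z = mk< g 0<g (eventually-map (λ n x+g≤y → ℚ.≤-trans x+g≤y (y≤z n)) sep)

≤-pointwise-< : ∀ {x y z} → (∀ n → seq x n ℚ.≤ seq y n) → y < z → x < z
≤-pointwise-< x≤y (mk< g 0<g sep) =
  mk< g 0<g (eventually-map (λ n y+g≤z → ℚ.≤-trans (ℚ.+-monoˡ-≤ g (x≤y n)) y+g≤z) sep)

x-y≈0⇒x≈y : ∀ {x y} → x - y ≈ 0ℝ → x ≈ y
x-y≈0⇒x≈y {x} {y} h = begin
  x            ≈⟨ pointwise (λ n → solve 2 (λ x y → x := (x :- y) :+ y) refl (seq x n) (seq y n)) ⟩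
  x - y + y    ≈⟨ +-cong h ≈-refl ⟩
  0ℝ + y       ≈⟨ R.+-identityˡ y ⟩
  y            ∎

U-2 : ∀ n → U 2ℝ n ≈ fromℕ n
U-2 n = pointwise λ s → trans (seq-U 2ℝ n s) (Uℚ-2 n)

product-positive : ∀ {n} (f : Fin n → ℝ) → (∀ i → 0ℝ < f i) → 0ℝ < product f
product-positive {zero}  f 0<f = fromℕ-mono-< {0} {1} (ℕ.s≤s ℕ.z≤n)
product-positive {suc n} f 0<f = 0<x*y (0<f zero) (product-positive (λ i → f (suc i)) (λ i → 0<f (suc i)))

-- Above the second largest root, the product x - γ i over i ≥ 1 is positive, so the only zero is γ 0.
roots-above-second : ∀ {v} {A : Matrix v} {γ} → IsSpectrum A γ → ∀ i → toℕ i ≡ 1 →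
  ∀ {x y} → γ i < x → γ i < y → charPoly A x ≈ 0ℝ → charPoly A y ≈ 0ℝ → x ≈ y
roots-above-second {suc (suc v)} {A} {γ} spectrum (suc zero) refl {x} {y} γ₁<x γ₁<y x-root y-root =
  ≈-trans (is-γ₀ γ₁<x x-root) (≈-sym (is-γ₀ γ₁<y y-root))
  where
  open IsSpectrum spectrum
  is-γ₀ : ∀ {z} → γ (suc zero) < z → charPoly A z ≈ 0ℝ → z ≈ γ zero
  is-γ₀ {z} γ₁<z z-root = x-y≈0⇒x≈y (0<y∧x*y≈0⇒x≈0 {y = product (λ i → z - γ (suc i))}
    (product-positive (λ i → z - γ (suc i))
      (λ i → x<y⇒0<y-x (≤-<-trans (decreases (suc zero) (suc i) (ℕ.s≤s ℕ.z≤n)) γ₁<z)))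
    (≈-trans (≈-sym (factors z)) z-root))

-- The first index is given through `toℕ`, because the size of a product graph is not a successor by
-- form.
eigenvector⇒root : ∀ {v} (A : Matrix v) (u : Fin v → ℝ) x →
  (∀ i → sum (λ j → A i j * u j) ≈ x * u i) →
  ∀ i → toℕ i ≡ 0 → u i ≈ 1ℝ → charPoly A x ≈ 0ℝ
eigenvector⇒root {suc v} A u x Au≈xu zero refl u₀≈1 =
  kernel⇒det≈0 (λ i j → x * identity i j - A i j) u kernel u₀≈1
  where
  identity-indicator : ∀ i j → identity i j ≈ indicator (i Fin.≟ j)
  identity-indicator i j with i Fin.≟ j
  ... | yes _ = ≈-refl
  ... | no  _ = ≈-refl
  expand : ∀ e a u → (x * e - a) * u ≈ x * (e * u) + - 1ℝ * (a * u)
  expand e a u = pointwise λ n → solve 4 (λ x e a u →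
    (x :* e :- a) :* u := x :* (e :* u) :+ (:- con 1ℚ) :* (a :* u)) refl
    (seq x n) (seq e n) (seq a n) (seq u n)
  kernel : ∀ i → sum (λ j → (x * identity i j - A i j) * u j) ≈ 0ℝ
  kernel i = begin
    sum (λ j → (x * identity i j - A i j) * u j)
      ≈⟨ sum-cong-≋ (λ j → ≈-trans
           (*-cong (+-cong (*-congˡ {x} (identity-indicator i j)) ≈-refl) ≈-refl)
           (expand (indicator (i Fin.≟ j)) (A i j) (u j))) ⟩
    sum (λ j → x * (indicator (i Fin.≟ j) * u j) + - 1ℝ * (A i j * u j))
      ≈⟨ ∑-distrib-+ (λ j → x * (indicator (i Fin.≟ j) * u j)) (λ j → - 1ℝ * (A i j * u j)) ⟩
    sum (λ j → x * (indicator (i Fin.≟ j) * u j)) + sum (λ j → - 1ℝ * (A i j * u j))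
      ≈⟨ +-cong (*-distribˡ-sum x (λ j → indicator (i Fin.≟ j) * u j)) (*-distribˡ-sum (- 1ℝ) (λ j → A i j * u j)) ⟨
    x * sum (λ j → indicator (i Fin.≟ j) * u j) + - 1ℝ * sum (λ j → A i j * u j)
      ≈⟨ +-cong (*-congˡ {x} (sum-indicator i u)) (*-congˡ { - 1ℝ} (Au≈xu i)) ⟩
    x * u i + - 1ℝ * (x * u i)
      ≈⟨ pointwise (λ n → solve 1 (λ a → a :+ (:- con 1ℚ) :* a := con 0ℚ) refl (seq (x * u i) n)) ⟩
    0ℝ ∎

0<fromℕ-suc : ∀ n → 0ℝ < fromℕ (suc n)
0<fromℕ-suc n = fromℕ-mono-< {0} {suc n} (ℕ.s≤s ℕ.z≤n)

2+fromℕ : ∀ k → fromℕ (2 ℕ.+ k) ≈ 2ℝ + fromℕ k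
2+fromℕ k = pointwise λ _ → ℕ→ℚ-+ 2 k

-- CA at x = 0 is s (s - 1) (l - s + 2), which is negative for s = k + 3 and l < k + 1.
rulesOut : ∀ {v} (G : Graph v) k → λmax G ℕ.≤ k → RulesOutCliques G (3 ℕ.+ k)
rulesOut {v} G k λmax≤k κ l _ _ _ l≤λmax = + 0 , 0<y-x⇒x<y (<-resp-≈ ≈-refl
  (pointwise λ n → expand (ℕ→ℚ v) (seq κ n) (seq l n) (ℕ→ℚ (1 ℕ.+ k)) (ℕ→ℚ (2 ℕ.+ k)) (ℕ→ℚ (3 ℕ.+ k))
    (ℕ→ℚ-suc (1 ℕ.+ k)) (ℕ→ℚ-suc (2 ℕ.+ k)))
  (0<x*y (0<x*y (0<fromℕ-suc (2 ℕ.+ k)) (0<fromℕ-suc (1 ℕ.+ k)))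
         (x<y⇒0<y-x (≤-<-trans l≤λmax (fromℕ-mono-< (ℕ.s≤s λmax≤k))))))
  where
  expand : ∀ V κ l K₁ K₂ S → K₂ ≡ 1ℚ ℚ.+ K₁ → S ≡ 1ℚ ℚ.+ K₂ →
    S ℚ.* K₂ ℚ.* (K₁ ℚ.- l) ≡
    0ℚ ℚ.- ((0ℚ ℚ.* (0ℚ ℚ.+ 1ℚ) ℚ.* (V ℚ.- S) ℚ.- 2ℚ ℚ.* 0ℚ ℚ.* S ℚ.* (κ ℚ.- S ℚ.+ 1ℚ))
           ℚ.+ S ℚ.* (S ℚ.- 1ℚ) ℚ.* (l ℚ.- S ℚ.+ 2ℚ))
  expand V κ l K₁ _ _ refl refl = solve 4 (λ V κ l K₁ →
    let 1# = con 1ℚ ; 0# = con 0ℚ ; 2# = con 2ℚ ; K₂ = 1# :+ K₁ ; S = 1# :+ K₂ in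
    S :* K₂ :* (K₁ :- l) :=
    0# :- ((0# :* (0# :+ 1#) :* (V :- S) :- 2# :* 0# :* S :* (κ :- S :+ 1#))
           :+ S :* (S :- 1#) :* (l :- S :+ 2#))) refl V κ l K₁

hoffmanBound> : ∀ {v k γ₂ b} → 2 ℕ.+ k ℕ.< v → b ℕ.≤ 2 ℕ.+ k → fromℕ (1 ℕ.+ k) < γ₂ →
  Σ[ den#0 ∈ hoffmanDenominator v (2 ℕ.+ k) γ₂ # 0ℝ ] (fromℕ b < hoffmanBound v (2 ℕ.+ k) γ₂ den#0)
hoffmanBound> {v} {k} {γ₂} {b} d<v b≤d k+1<γ₂ = inj₂ 0<den ,
  ≤-pointwise-< (λ _ → ℕ→ℚ-mono-≤ b≤d) (0<y-x⇒x<y (<-resp-≈ ≈-refl difference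
    (0<x*y (0<x+y (0<x*y 0<V-D (x<y⇒0<y-x k+1<γ₂)) (0<fromℕ-suc (1 ℕ.+ k))) (0<inverse 0<den))))
  where
  V = fromℕ v
  D = fromℕ (2 ℕ.+ k)
  K₁ = fromℕ (1 ℕ.+ k)
  den = hoffmanDenominator v (2 ℕ.+ k) γ₂
  0<V-D : 0ℝ < V - D
  0<V-D = x<y⇒0<y-x (fromℕ-mono-< d<v)
  0<den : 0ℝ < den
  -- Both v - d and γ₂ > k + 1 are positive, which also settles that the division is legitimate.
  0<den = 0<x+y 0<V-D (≤-pointwise-< (λ _ → ℕ→ℚ-mono-≤ {0} {1 ℕ.+ k} ℕ.z≤n) k+1<γ₂)
  den⁻¹ = inverse den (inj₂ 0<den)
  expand : ∀ V D K₁ g i → D ≡ 1ℚ ℚ.+ K₁ → ((V ℚ.- D) ℚ.* (g ℚ.- K₁) ℚ.+ D) ℚ.* i ≡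
    V ℚ.* (1ℚ ℚ.+ g) ℚ.* i ℚ.- D ℚ.* ((V ℚ.- D ℚ.+ g) ℚ.* i)
  expand V _ K₁ g i refl = solve 4 (λ V K₁ g i →
    let D = con 1ℚ :+ K₁ in
    ((V :- D) :* (g :- K₁) :+ D) :* i := V :* (con 1ℚ :+ g) :* i :- D :* ((V :- D :+ g) :* i)) refl V K₁ g i
  difference : ((V - D) * (γ₂ - K₁) + D) * den⁻¹ ≈ hoffmanBound v (2 ℕ.+ k) γ₂ (inj₂ 0<den) - D
  difference = begin
    ((V - D) * (γ₂ - K₁) + D) * den⁻¹
      ≈⟨ pointwise (λ n → expand (ℕ→ℚ v) (ℕ→ℚ (2 ℕ.+ k)) (ℕ→ℚ (1 ℕ.+ k)) (seq γ₂ n) (seq den⁻¹ n)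
           (ℕ→ℚ-suc (1 ℕ.+ k))) ⟩
    V * (1ℝ + γ₂) * den⁻¹ - D * (den * den⁻¹)
      ≈⟨ +-cong ≈-refl (neg-cong (≈-trans (*-congˡ {D} (*-inverse 0<den)) (R.*-identityʳ D))) ⟩
    V * (1ℝ + γ₂) * den⁻¹ - D ∎

module _ {m} (Γ : Graph m) {k} (regular : IsRegular Γ k) {n : ℕ} (4≤n : 4 ℕ.≤ n) where

  private
    G = Γ □ cycle n
    3≤n : 3 ℕ.≤ n
    3≤n = ℕ.≤-trans (ℕ.n≤1+n 3) 4≤n
    open □-Rows Γ (cycle n)

  □-cycle-row : ∀ p (f : ℕ → ℝ) → f n ≈ f 0 → f (suc n) ≈ f 1 →
    sum (λ q → adjacency G p q * f (suc (toℕ (snd q)))) ≈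
    (f (suc (suc (toℕ (snd p)))) + f (toℕ (snd p))) + fromℕ k * f (suc (toℕ (snd p)))
  □-cycle-row p f fn≈f0 f1+n≈f1 = ≈-trans (□-row regular p (λ j → f (suc (toℕ j))))
    (+-cong (CycleNeighbours.cycle-row 3≤n (snd p) f fn≈f0 f1+n≈f1) ≈-refl)

  -- The row formula applied to the constant function 1, read back in the natural numbers.
  □-cycle-degree : ∀ p → degree G p ≡ 2 ℕ.+ k
  □-cycle-degree p = fromℕ-injective (begin
    fromℕ (degree G p)                        ≈⟨ degree≈sum G p ⟩
    sum (adjacency G p)                       ≈⟨ sum-cong-≋ {m ℕ.* n} (λ q → R.*-identityʳ (adjacency G p q)) ⟨
    sum (λ q → adjacency G p q * 1ℝ)          ≈⟨ □-cycle-row p (λ _ → 1ℝ) ≈-refl ≈-refl ⟩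
    (1ℝ + 1ℝ) + fromℕ k * 1ℝ                  ≈⟨ +-cong (pointwise λ _ → refl) (R.*-identityʳ (fromℕ k)) ⟩
    2ℝ + fromℕ k                              ≈⟨ 2+fromℕ k ⟨
    fromℕ (2 ℕ.+ k)                           ∎)

  -- Serves both eigenvalues: f is `U t` for the cyclic root and the constant 1 for t = 2, where
  -- `U 2ℝ` grows linearly and is not periodic.
  recurrence⇒root : ∀ t (f : ℕ → ℝ) → (∀ j → f (suc (suc j)) + f j ≈ t * f (suc j)) →
    f n ≈ f 0 → f (suc n) ≈ f 1 → f 1 ≈ 1ℝ →
    ∀ p → toℕ p ≡ 0 → charPoly (adjacency G) (t + fromℕ k) ≈ 0ℝ
  recurrence⇒root t f rec fn≈f0 f1+n≈f1 f1≈1 p p≡0 =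
    eigenvector⇒root (adjacency G) (λ q → f (suc (toℕ (snd q)))) (t + fromℕ k)
      (λ q → begin
        sum (λ q′ → adjacency G q q′ * f (suc (toℕ (snd q′))))
          ≈⟨ □-cycle-row q f fn≈f0 f1+n≈f1 ⟩
        (f (suc (suc (toℕ (snd q)))) + f (toℕ (snd q))) + fromℕ k * f (suc (toℕ (snd q)))
          ≈⟨ +-cong (rec (toℕ (snd q))) ≈-refl ⟩
        t * f (suc (toℕ (snd q))) + fromℕ k * f (suc (toℕ (snd q)))
          ≈⟨ R.distribʳ (f (suc (toℕ (snd q)))) t (fromℕ k) ⟨
        (t + fromℕ k) * f (suc (toℕ (snd q))) ∎)
      p p≡0 (≈-trans (≡⇒≈ (cong (λ j → f (suc j)) snd≡0)) f1≈1)
    where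
    snd≡0 : toℕ (snd p) ≡ 0
    snd≡0 = ℕ.m+n≡0⇒n≡0 (n ℕ.* toℕ (fst p)) (trans (sym (Fin.toℕ-combine (fst p) (snd p)))
      (trans (cong toℕ (Fin.combine-remQuot {m} n p)) p≡0))

  edgeDegree≤ : ∀ p q → _~_ G p q → edgeDegree G (p , q) ℕ.≤ k
  edgeDegree≤ p q p~q = ℕ.+-cancelˡ-≤ 2 _ _ (ℕ.≤-trans
    (edgeDegree+2≤degree G {p} {q} {r next} {r prev}
      (λ r≡r′ → next≢prev (trans (sym (snd-r next)) (trans (cong snd r≡r′) (snd-r prev))))
      (p~r next~) (p~r prev~) (q≁r next~) (q≁r prev~))
    (ℕ.≤-reflexive (□-cycle-degree p)))
    where
    open CycleNeighbours 3≤n (snd p)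
    2≤n = ℕ.≤-trans (ℕ.n≤1+n 2) 3≤n
    next~ : _~_ (cycle n) (snd p) next
    next~ = cycle-adjacent 2≤n (inj₁ (proj₂ (successor (snd p))))
    prev~ : _~_ (cycle n) (snd p) prev
    prev~ = cycle-adjacent 2≤n (inj₂ (proj₂ (predecessor (snd p))))
    r : Fin n → Fin (m ℕ.* n)
    r j = combine (fst p) j
    fst-r : ∀ j → fst (r j) ≡ fst p
    fst-r j = cong proj₁ (Fin.remQuot-combine (fst p) j)
    snd-r : ∀ j → snd (r j) ≡ j
    snd-r j = cong proj₂ (Fin.remQuot-combine (fst p) j)
    p~r : ∀ {j} → _~_ (cycle n) (snd p) j → _~_ G p (r j)
    p~r {j} b~j = inj₁ (sym (fst-r j) , subst (_~_ (cycle n) (snd p)) (sym (snd-r j)) b~j)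
    q≁r : ∀ {j} → _~_ (cycle n) (snd p) j → ¬ _~_ G q (r j)
    q≁r {j} b~j q~r = separate p~q q~r
      where
      -- Two cycle edges would close a triangle in the cycle, one edge of each kind would give a
      -- loop in Γ, and two edges of Γ would give a loop in the cycle.
      separate : _~_ G p q → ¬ _~_ G q (r j)
      separate (inj₁ (a≡a′ , b~b′)) (inj₁ (_ , b′~j)) =
        cycle-triangle-free 4≤n b~b′ (subst (_~_ (cycle n) (snd q)) (snd-r j) b′~j) b~j
      separate (inj₁ (a≡a′ , _)) (inj₂ (_ , a′~a)) = ~-irr Γ (subst (_~_ Γ (fst q)) (trans (fst-r j) a≡a′) a′~a)
      separate (inj₂ (_ , a~a′)) (inj₁ (a′≡a , _)) = ~-irr Γ (subst (_~_ Γ (fst p)) (trans a′≡a (fst-r j)) a~a′)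
      separate (inj₂ (b≡b′ , _)) (inj₂ (b′≡j , _)) =
        ~-irr (cycle n) (subst (_~_ (cycle n) (snd p)) (sym (trans b≡b′ (trans b′≡j (snd-r j)))) b~j)

  k+1<secondLargest : ∀ {γ₂} → CyclicRoot n →
    IsSecondLargestEigenvalue (adjacency G) γ₂ → fromℕ (1 ℕ.+ k) < γ₂
  k+1<secondLargest cyclic (γ , spectrum , j , j≡1 , γ₂≈γⱼ) = <-resp-≈ ≈-refl (≈-sym γ₂≈γⱼ)
    (choose (<-cotrans (fromℚ-mono-< k+1<t₀+k) (γ j)))
    where
    t₀+k = t₀ ℚ.+ ℕ→ℚ k
    k+1<t₀+k : ℕ→ℚ (1 ℕ.+ k) ℚ.< t₀+k
    k+1<t₀+k = subst (ℚ._< t₀+k) (sym (ℕ→ℚ-suc k)) (ℚ.+-monoˡ-< (ℕ→ℚ k) (from-yes (1ℚ ℚ.<? t₀)))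
    -- Any index shows that the vertex set is inhabited, hence that vertex 0 exists.
    first : ∀ {v} (j : Fin v) → ∃[ p ] toℕ {v} p ≡ 0
    first {suc v} _ = zero , refl
    open CyclicRoot cyclic
    -- Both k + t and k + 2 would be roots above the second one, forcing t = 2 and thus n = `U 2ℝ n`
    -- = 0.
    absurd : ¬ (γ j < fromℚ t₀+k)
    absurd γⱼ<t₀+k = <-irrefl (≈-sym n≈0) (fromℕ-mono-< {0} {n} (ℕ.≤-trans (ℕ.s≤s ℕ.z≤n) 4≤n))
      where
      p = proj₁ (first j)
      p≡0 = proj₂ (first j)
      t+k≈2+k : t + fromℕ k ≈ 2ℝ + fromℕ k
      t+k≈2+k = roots-above-second spectrum j j≡1
        (<-≤-pointwise γⱼ<t₀+k (λ l → ℚ.+-monoˡ-≤ (ℕ→ℚ k) (t₀≤t l)))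
        (<-≤-pointwise γⱼ<t₀+k (λ _ → ℚ.+-monoˡ-≤ (ℕ→ℚ k) (from-yes (t₀ ℚ.≤? 2ℚ))))
        (recurrence⇒root t (U t)
          (λ l → pointwise λ s → solve 2 (λ a b → (a :- b) :+ b := a) refl
            (seq (t * U t (suc l)) s) (seq (U t l) s))
          U[n]≈0 U[1+n]≈1 ≈-refl p p≡0)
        (recurrence⇒root 2ℝ (λ _ → 1ℝ) (λ _ → pointwise λ _ → refl) ≈-refl ≈-refl ≈-refl p p≡0)
      t≈2 : t ≈ 2ℝ
      t≈2 = begin
        t                            ≈⟨ pointwise (λ s → solve 2 (λ t k → t := (t :+ k) :- k) refl (seq t s) (ℕ→ℚ k)) ⟩
        t + fromℕ k - fromℕ k        ≈⟨ +-cong t+k≈2+k ≈-refl ⟩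
        2ℝ + fromℕ k - fromℕ k       ≈⟨ pointwise (λ s → solve 1 (λ k → (con 2ℚ :+ k) :- k := con 2ℚ) refl (ℕ→ℚ k)) ⟩
        2ℝ                           ∎
      n≈0 : fromℕ n ≈ 0ℝ
      n≈0 = begin
        fromℕ n      ≈⟨ U-2 n ⟨
        U 2ℝ n       ≈⟨ U-cong n t≈2 ⟨
        U t n        ≈⟨ U[n]≈0 ⟩
        0ℝ           ∎
    choose : fromℕ (1 ℕ.+ k) < γ j ⊎ γ j < fromℚ t₀+k → fromℕ (1 ℕ.+ k) < γ j
    choose (inj₁ k+1<γⱼ) = k+1<γⱼ
    choose (inj₂ γⱼ<t₀+k) = contradiction γⱼ<t₀+k absurd

theorem5p8 : ∀ {m} (Γ : Graph m) (k : ℕ) → IsRegular Γ k →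
    ∃[ N ] (∀ n → N ℕ.≤ n →
    ∀ (d : ℕ) (γ₂ : ℝ) (b : ℕ) →
    IsRegular (Γ □ cycle n) d →
    IsSecondLargestEigenvalue (adjacency (Γ □ cycle n)) γ₂ →
    IsGeneralisedCAPBound (Γ □ cycle n) b →
    Σ[ den#0 ∈ hoffmanDenominator (m ℕ.* n) d γ₂ # 0ℝ ]
    (fromℕ b < hoffmanBound (m ℕ.* n) d γ₂ den#0))
-- From 10 on a cyclic root exists, and the cycle has no triangles; the summand k yields v ≥ n > k +
-- 2, so that v - d is positive.
theorem5p8 {m} Γ k regular = 10 ℕ.+ k , λ n N≤n d γ₂ b G-regular second cap →
  -- The index of the second eigenvalue doubles as a vertex: it allows d to be compared with k + 2
  -- and shows that m is not 0.
  let p       = proj₁ (proj₂ (proj₂ second))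
      10≤n    = ℕ.≤-trans (ℕ.m≤m+n 10 k) N≤n
      4≤n     = ℕ.≤-trans (ℕ.m≤m+n 4 6) 10≤n
      cyclic  = subst CyclicRoot (ℕ.m+[n∸m]≡n 10≤n) (cyclicRoot (n ℕ.∸ 10))
      d≡2+k   = trans (sym (G-regular p)) (□-cycle-degree Γ regular 4≤n p)
      b≤2+k   = IsGeneralisedCAPBound.least cap (2 ℕ.+ k)
                  (rulesOut (Γ □ cycle n) k (λmax≤ (Γ □ cycle n) (edgeDegree≤ Γ regular 4≤n)))
  in subst (λ d → Σ[ den#0 ∈ hoffmanDenominator (m ℕ.* n) d γ₂ # 0ℝ ]
                    (fromℕ b < hoffmanBound (m ℕ.* n) d γ₂ den#0)) (sym d≡2+k)
       (hoffmanBound> (k+2<mn m n N≤n p) b≤2+k (k+1<secondLargest Γ regular 4≤n cyclic second))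
  where
  k+2<mn : ∀ m n → 10 ℕ.+ k ℕ.≤ n → Fin (m ℕ.* n) → 2 ℕ.+ k ℕ.< m ℕ.* n
  k+2<mn (suc m) n N≤n _ = ℕ.≤-trans (ℕ.m≤n+m (3 ℕ.+ k) 7) (ℕ.≤-trans N≤n (ℕ.m≤m+n n (m ℕ.* n)))
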